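{- Let $k$ and $n$ be positive integers, and consider $k$-uniform hypergraphs $\mathcal{H}$ with $n$ vertices. Then the following hold. (i) For every such $\mathcal{H}$, $\mathcal{E}(\mathcal{S}(\mathcal{H}))\ge\sqrt{n(n-1)}$. (ii) If for some such $\mathcal{H}$ equality holds in the inequality $\mathcal{E}(\mathcal{S}(\mathcal{H}))\ge\sqrt{n(n-1)}$, then $\mathcal{H}$ is linear. (iii) For every linear $k$-uniform hypergraph $\mathcal{H}$ on $n$ vertices, $$\sqrt{n(n-1)}\le\mathcal{E}(\mathcal{S}(\mathcal{H}))\le n\sqrt{n-1}.$$
   Context: A hypergraph $\mathcal{H}=(V,E)$ consists of a finite vertex set $V$ with $|V|=n$ (identified with $\{1,\dots,n\}$) and a set $E\subseteq 2^{V}$ of hyperedges. All hypergraphs are finite and simple: there is no hyperedge of size $1$, and for distinct hyperedges $e,e'$ neither $e\subset e'$ nor $e'\subset e$. $\mathcal{H}$ is $k$-uniform if every hyperedge has exactly $k$ elements. For distinct vertices $i,j$, the co-degree is $c_{ij}=|\{e\in E: i,j\in e\}|$. The Seidel matrix $\mathcal{S}(\mathcal{H})$ is the real symmetric $n\times n$ matrix with $\mathcal{S}(\mathcal{H})_{ii}=0$ and $\mathcal{S}(\mathcal{H})_{ij}=1-2c_{ij}$ for $i\ne j$. If $\rho_1,\dots,\rho_n$ are its eigenvalues (with multiplicity), the Seidel energy is $\mathcal{E}(\mathcal{S}(\mathcal{H}))=\sum_{i=1}^n|\rho_i|$. A hypergraph is linear if it is simple and $|e\cap e'|\le 1$ for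 all distinct hyperedges $e,e'$. -}

module Defs where

open import Algebra.Bundles.Raw using (RawRing)
import Algebra.Definitions.RawMonoid as RawSum
import Algebra.Definitions.RawSemiring as RawPower
open import Data.Bool.Base using (if_then_else_)
open import Data.Fin.Base using (Fin; zero; suc; toℕ; punchIn)
import Data.Fin.Properties as Fin
open import Data.Fin.Subset using (Subset; _⊆_; _∩_; ∣_∣)
open import Data.Fin.Subset.Properties using (_∈?_)
open import Data.Integer.Base as ℤ using (ℤ; +_; 1ℤ)
import Data.Integer.Properties as ℤ
import Data.Integer.Solver as ℤ
open import Data.List.Base using (List; []; _∷_; map; filter; length)
open import Data.List.Membership.Propositional using (_∈_)
open import Data.List.Relation.Unary.Unique.Propositional using (Unique)
open import Data.Nat.Base as ℕ using (ℕ; zero; suc)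
import Data.Nat.Properties as ℕ
open import Data.Nat.Solver using (module +-*-Solver)
open import Data.Product.Base using (∃; _×_; _,_; proj₁; proj₂)
open import Data.Rational.Base as ℚ using (ℚ; 0ℚ; 1ℚ; ½)
import Data.Rational.Properties as ℚ
import Data.Rational.Solver as ℚ
open import Data.Rational.Unnormalised.Base as ℚᵘ using (mkℚᵘ; *<*)
import Data.Rational.Unnormalised.Properties as ℚᵘ
open import Data.Sum.Base using ([_,_]′)
open import Data.Vec.Functional using (Vector)
open import Level using (0ℓ)
open import Relation.Binary.PropositionalEquality
open import Relation.Nullary using (¬_; yes; no; does)
open import Relation.Nullary.Decidable using (_×-dec_)

------------------------------------------------------------------------
-- Polynomials and determinants

-- A polynomial is its list of coefficients, constant term first;
-- trailing zeros are allowed.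
module Polynomial (R : RawRing 0ℓ 0ℓ) where
  open RawRing R

  Poly : Set
  Poly = List Carrier

  coeff : Poly → ℕ → Carrier
  coeff []      _       = 0#
  coeff (a ∷ p) zero    = a
  coeff (a ∷ p) (suc k) = coeff p k

  infix  4 _≈ₚ_
  infixl 6 _+ₚ_
  infixl 7 _*ₚ_

  _≈ₚ_ : Poly → Poly → Set
  p ≈ₚ q = ∀ k → coeff p k ≈ coeff q k

  _+ₚ_ : Poly → Poly → Poly
  []      +ₚ q       = q
  (a ∷ p) +ₚ []      = a ∷ p
  (a ∷ p) +ₚ (b ∷ q) = a + b ∷ p +ₚ q

  _*ₚ_ : Poly → Poly → Poly
  []      *ₚ q = []
  (a ∷ p) *ₚ q = map (a *_) q +ₚ (0# ∷ p *ₚ q)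

  -ₚ_ : Poly → Poly
  -ₚ p = map (λ a → - a) p

  const : Carrier → Poly
  const a = a ∷ []

  X : Poly
  X = 0# ∷ 1# ∷ []

  rawRing : RawRing 0ℓ 0ℓ
  rawRing = record
    { Carrier = Poly
    ; _≈_     = _≈ₚ_
    ; _+_     = _+ₚ_
    ; _*_     = _*ₚ_
    ; -_      = -ₚ_
    ; 0#      = []
    ; 1#      = const 1#
    }

module Sums (R : RawRing 0ℓ 0ℓ) where
  open RawRing R
  open RawSum +-rawMonoid public using () renaming (sum to ∑)
  open RawSum *-rawMonoid public using () renaming (sum to ∏)

Matrix : Set → ℕ → Set
Matrix A n = Fin n → Fin n → A

module Determinant (R : RawRing 0ℓ 0ℓ) where
  open RawRing R
  open RawPower rawSemiring using (_^_)
  open Sums R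

  minor : ∀ {n} → Matrix Carrier (suc n) → Fin (suc n) → Matrix Carrier n
  minor M j i l = M (suc i) (punchIn j l)

  -- Laplace expansion along the first row
  det : ∀ n → Matrix Carrier n → Carrier
  det zero    M = 1#
  det (suc n) M = ∑ λ j → (- 1#) ^ toℕ j * (M zero j * det n (minor M j))

------------------------------------------------------------------------
-- Cauchy sequences of rationals

IsCauchy : (ℕ → ℚ) → Set
IsCauchy x = ∀ ε → 0ℚ ℚ.< ε →
  ∃ λ N → ∀ i j → N ℕ.≤ i → N ℕ.≤ j → ℚ.∣ x i ℚ.- x j ∣ ℚ.< ε

private module ℚS = ℚ.+-*-Solver

half-pos : ∀ {ε} → 0ℚ ℚ.< ε → 0ℚ ℚ.< ½ ℚ.* ε
half-pos {ε} 0<ε =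
  subst (ℚ._< ½ ℚ.* ε) (ℚ.*-zeroʳ ½) (ℚ.*-monoʳ-<-pos ½ 0<ε)

halves : ∀ ε → ½ ℚ.* ε ℚ.+ ½ ℚ.* ε ≡ ε
halves ε = trans (sym (ℚ.*-distribʳ-+ ε ½ ½)) (ℚ.*-identityˡ ε)

-- δ = ε / B
quotient : ∀ {B ε} → 0ℚ ℚ.< B → 0ℚ ℚ.< ε → ∃ λ δ → 0ℚ ℚ.< δ × B ℚ.* δ ≡ ε
quotient {B} {ε} 0<B 0<ε = 1/B ℚ.* ε , 0<δ , (begin
  B ℚ.* (1/B ℚ.* ε)  ≡⟨ ℚ.*-assoc B 1/B ε ⟨
  B ℚ.* 1/B ℚ.* ε    ≡⟨ cong (ℚ._* ε) (ℚ.*-inverseʳ B) ⟩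
  1ℚ ℚ.* ε           ≡⟨ ℚ.*-identityˡ ε ⟩
  ε                  ∎)
  where
  open ≡-Reasoning
  instance
    B-pos = ℚ.positive 0<B
    B-nonZero = ℚ.pos⇒nonZero B
  1/B = ℚ.1/ B
  instance
    1/B-pos = ℚ.1/pos⇒pos B
  0<δ : 0ℚ ℚ.< 1/B ℚ.* ε
  0<δ = subst (ℚ._< 1/B ℚ.* ε) (ℚ.*-zeroʳ 1/B) (ℚ.*-monoʳ-<-pos 1/B 0<ε)

const-cauchy : ∀ q → IsCauchy (λ _ → q)
const-cauchy q ε 0<ε = 0 , λ _ _ _ _ →
  subst (ℚ._< ε) (sym (cong ℚ.∣_∣ (ℚ.+-inverseʳ q))) 0<ε

+-cauchy : ∀ x y → IsCauchy x → IsCauchy y → IsCauchy (λ k → x k ℚ.+ y k)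
+-cauchy x y cx cy ε 0<ε
  = M ℕ.⊔ N , λ i j i≥ j≥ → begin-strict
  ℚ.∣ (x i ℚ.+ y i) ℚ.- (x j ℚ.+ y j) ∣
    ≡⟨ cong ℚ.∣_∣ (rearrange (x i) (y i) (x j) (y j)) ⟩
  ℚ.∣ (x i ℚ.- x j) ℚ.+ (y i ℚ.- y j) ∣
    ≤⟨ ℚ.∣p+q∣≤∣p∣+∣q∣ (x i ℚ.- x j) (y i ℚ.- y j) ⟩
  ℚ.∣ x i ℚ.- x j ∣ ℚ.+ ℚ.∣ y i ℚ.- y j ∣
    <⟨ ℚ.+-mono-< (p i j (ℕ.m⊔n≤o⇒m≤o M N i≥) (ℕ.m⊔n≤o⇒m≤o M N j≥))
                  (q i j (ℕ.m⊔n≤o⇒n≤o M N i≥) (ℕ.m⊔n≤o⇒n≤o M N j≥)) ⟩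
  ½ ℚ.* ε ℚ.+ ½ ℚ.* ε
    ≡⟨ halves ε ⟩
  ε ∎
  where
  open ℚ.≤-Reasoning
  M = cx (½ ℚ.* ε) (half-pos 0<ε) .proj₁
  p = cx (½ ℚ.* ε) (half-pos 0<ε) .proj₂
  N = cy (½ ℚ.* ε) (half-pos 0<ε) .proj₁
  q = cy (½ ℚ.* ε) (half-pos 0<ε) .proj₂
  rearrange : ∀ a b c d →
    (a ℚ.+ b) ℚ.- (c ℚ.+ d) ≡ (a ℚ.- c) ℚ.+ (b ℚ.- d)
  rearrange = ℚS.solve 4 (λ a b c d →
    (a ℚS.:+ b) ℚS.:- (c ℚS.:+ d) ℚS.:= (a ℚS.:- c) ℚS.:+ (b ℚS.:- d)) refl

neg-cauchy : ∀ x → IsCauchy x → IsCauchy (λ k → ℚ.- x k)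
neg-cauchy x cx ε 0<ε = cx ε 0<ε .proj₁ , λ i j i≥ j≥ →
  subst (ℚ._< ε) (sym (begin
    ℚ.∣ ℚ.- x i ℚ.- ℚ.- x j ∣  ≡⟨ cong ℚ.∣_∣ (ℚ.neg-distrib-+ (x i) (ℚ.- x j)) ⟨
    ℚ.∣ ℚ.- (x i ℚ.- x j) ∣    ≡⟨ ℚ.∣-p∣≡∣p∣ (x i ℚ.- x j) ⟩
    ℚ.∣ x i ℚ.- x j ∣          ∎)) (cx ε 0<ε .proj₂ i j i≥ j≥)
  where open ≡-Reasoning

∣p∣-∣q∣≤∣p-q∣ : ∀ p q → ℚ.∣ p ∣ ℚ.- ℚ.∣ q ∣ ℚ.≤ ℚ.∣ p ℚ.- q ∣
∣p∣-∣q∣≤∣p-q∣ p q = begin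
  ℚ.∣ p ∣ ℚ.- ℚ.∣ q ∣
    ≡⟨ cong (λ r → ℚ.∣ r ∣ ℚ.- ℚ.∣ q ∣) (split p q) ⟩
  ℚ.∣ (p ℚ.- q) ℚ.+ q ∣ ℚ.- ℚ.∣ q ∣
    ≤⟨ ℚ.+-monoˡ-≤ (ℚ.- ℚ.∣ q ∣) (ℚ.∣p+q∣≤∣p∣+∣q∣ (p ℚ.- q) q) ⟩
  ℚ.∣ p ℚ.- q ∣ ℚ.+ ℚ.∣ q ∣ ℚ.- ℚ.∣ q ∣
    ≡⟨ cancel ℚ.∣ p ℚ.- q ∣ ℚ.∣ q ∣ ⟩
  ℚ.∣ p ℚ.- q ∣ ∎
  where
  open ℚ.≤-Reasoning
  split : ∀ a b → a ≡ (a ℚ.- b) ℚ.+ b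
  split = ℚS.solve 2 (λ a b → a ℚS.:= (a ℚS.:- b) ℚS.:+ b) refl
  cancel : ∀ a b → a ℚ.+ b ℚ.- b ≡ a
  cancel = ℚS.solve 2 (λ a b → a ℚS.:+ b ℚS.:- b ℚS.:= a) refl

neg-minus : ∀ a b → ℚ.- (a ℚ.- b) ≡ b ℚ.- a
neg-minus = ℚS.solve 2 (λ a b → ℚS.:- (a ℚS.:- b) ℚS.:= b ℚS.:- a) refl

∣p-q∣≡∣q-p∣ : ∀ p q → ℚ.∣ p ℚ.- q ∣ ≡ ℚ.∣ q ℚ.- p ∣
∣p-q∣≡∣q-p∣ p q =
  trans (sym (ℚ.∣-p∣≡∣p∣ (p ℚ.- q))) (cong ℚ.∣_∣ (neg-minus p q))

abs-bound : ∀ p q {ε} → p ℚ.- q ℚ.< ε → q ℚ.- p ℚ.< ε → ℚ.∣ p ℚ.- q ∣ ℚ.< ε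
abs-bound p q {ε} h₁ h₂ = [ (λ e → subst (ℚ._< ε) (sym e) h₁)
  , (λ e → subst (ℚ._< ε) (sym (trans e (neg-minus p q))) h₂)
  ]′ (ℚ.∣p∣≡p∨∣p∣≡-p (p ℚ.- q))

abs-cauchy : ∀ x → IsCauchy x → IsCauchy (λ k → ℚ.∣ x k ∣)
abs-cauchy x cx ε 0<ε = cx ε 0<ε .proj₁ , λ i j i≥ j≥ → abs-bound ℚ.∣ x i ∣ ℚ.∣ x j ∣
  (ℚ.≤-<-trans (∣p∣-∣q∣≤∣p-q∣ (x i) (x j)) (cx ε 0<ε .proj₂ i j i≥ j≥))
  (ℚ.≤-<-trans (∣p∣-∣q∣≤∣p-q∣ (x j) (x i)) (cx ε 0<ε .proj₂ j i j≥ i≥))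

tail-bound : ∀ {x} → IsCauchy x →
  ∃ λ B → 0ℚ ℚ.< B × ∃ λ N → ∀ i → N ℕ.≤ i → ℚ.∣ x i ∣ ℚ.≤ B
tail-bound {x} cx = 1ℚ ℚ.+ ℚ.∣ x N ∣ , 0<B , N , λ i i≥ → begin
  ℚ.∣ x i ∣                            ≡⟨ cong ℚ.∣_∣ (split (x i) (x N)) ⟩
  ℚ.∣ (x i ℚ.- x N) ℚ.+ x N ∣          ≤⟨ ℚ.∣p+q∣≤∣p∣+∣q∣ (x i ℚ.- x N) (x N) ⟩
  ℚ.∣ x i ℚ.- x N ∣ ℚ.+ ℚ.∣ x N ∣      ≤⟨ ℚ.+-monoˡ-≤ ℚ.∣ x N ∣ (ℚ.<⇒≤ (p i N i≥ ℕ.≤-refl)) ⟩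
  1ℚ ℚ.+ ℚ.∣ x N ∣                     ∎
  where
  open ℚ.≤-Reasoning
  split : ∀ a b → a ≡ (a ℚ.- b) ℚ.+ b
  split = ℚS.solve 2 (λ a b → a ℚS.:= (a ℚS.:- b) ℚS.:+ b) refl
  N = cx 1ℚ (ℚ.positive⁻¹ 1ℚ) .proj₁
  p = cx 1ℚ (ℚ.positive⁻¹ 1ℚ) .proj₂
  0<B : 0ℚ ℚ.< 1ℚ ℚ.+ ℚ.∣ x N ∣
  0<B = ℚ.+-mono-<-≤ (ℚ.positive⁻¹ 1ℚ) (ℚ.0≤∣p∣ (x N))

-- ∣ab∣ < ε whenever ∣a∣ ≤ B, ∣b∣ < δ and Bδ = ε
small-product : ∀ {B δ ε} → 0ℚ ℚ.< B → B ℚ.* δ ≡ ε →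
  ∀ a b → ℚ.∣ a ∣ ℚ.≤ B → ℚ.∣ b ∣ ℚ.< δ → ℚ.∣ a ℚ.* b ∣ ℚ.< ε
small-product {B} {δ} {ε} 0<B eq a b a≤ b< = begin-strict
  ℚ.∣ a ℚ.* b ∣          ≡⟨ ℚ.∣p*q∣≡∣p∣*∣q∣ a b ⟩
  ℚ.∣ a ∣ ℚ.* ℚ.∣ b ∣    ≤⟨ ℚ.*-monoʳ-≤-nonNeg ℚ.∣ b ∣ {{ℚ.∣-∣-nonNeg b}} a≤ ⟩
  B ℚ.* ℚ.∣ b ∣          <⟨ ℚ.*-monoʳ-<-pos B {{ℚ.positive 0<B}} b< ⟩
  B ℚ.* δ                ≡⟨ eq ⟩
  ε                      ∎
  where open ℚ.≤-Reasoning

*-cauchy : ∀ x y → IsCauchy x → IsCauchy y → IsCauchy (λ k → x k ℚ.* y k)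
*-cauchy x y cx cy ε 0<ε =
  let A , 0<A , K , a = tail-bound cx
      B , 0<B , L , b = tail-bound cy
      α , 0<α , Aα = quotient 0<A (half-pos 0<ε)
      β , 0<β , Bβ = quotient 0<B (half-pos 0<ε)
      M , p = cy α 0<α
      N , q = cx β 0<β
  in
  (K ℕ.⊔ L) ℕ.⊔ (M ℕ.⊔ N) , λ i j i≥ j≥ → begin-strict
  ℚ.∣ x i ℚ.* y i ℚ.- x j ℚ.* y j ∣
    ≡⟨ cong ℚ.∣_∣ (rearrange (x i) (y i) (x j) (y j)) ⟩
  ℚ.∣ x i ℚ.* (y i ℚ.- y j) ℚ.+ y j ℚ.* (x i ℚ.- x j) ∣
    ≤⟨ ℚ.∣p+q∣≤∣p∣+∣q∣ (x i ℚ.* (y i ℚ.- y j)) (y j ℚ.* (x i ℚ.- x j)) ⟩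
  ℚ.∣ x i ℚ.* (y i ℚ.- y j) ∣ ℚ.+ ℚ.∣ y j ℚ.* (x i ℚ.- x j) ∣
    <⟨ ℚ.+-mono-<
         (small-product 0<A Aα (x i) (y i ℚ.- y j) (a i (ℕ.m⊔n≤o⇒m≤o K L (ℕ.m⊔n≤o⇒m≤o (K ℕ.⊔ L) (M ℕ.⊔ N) i≥)))
           (p i j (ℕ.m⊔n≤o⇒m≤o M N (ℕ.m⊔n≤o⇒n≤o (K ℕ.⊔ L) (M ℕ.⊔ N) i≥))
                (ℕ.m⊔n≤o⇒m≤o M N (ℕ.m⊔n≤o⇒n≤o (K ℕ.⊔ L) (M ℕ.⊔ N) j≥))))
         (small-product 0<B Bβ (y j) (x i ℚ.- x j) (b j (ℕ.m⊔n≤o⇒n≤o K L (ℕ.m⊔n≤o⇒m≤o (K ℕ.⊔ L) (M ℕ.⊔ N) j≥)))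
           (q i j (ℕ.m⊔n≤o⇒n≤o M N (ℕ.m⊔n≤o⇒n≤o (K ℕ.⊔ L) (M ℕ.⊔ N) i≥))
                (ℕ.m⊔n≤o⇒n≤o M N (ℕ.m⊔n≤o⇒n≤o (K ℕ.⊔ L) (M ℕ.⊔ N) j≥)))) ⟩
  ½ ℚ.* ε ℚ.+ ½ ℚ.* ε
    ≡⟨ halves ε ⟩
  ε ∎
  where
  open ℚ.≤-Reasoning
  rearrange : ∀ a b c d →
    a ℚ.* b ℚ.- c ℚ.* d ≡ a ℚ.* (b ℚ.- d) ℚ.+ d ℚ.* (a ℚ.- c)
  rearrange = ℚS.solve 4 (λ a b c d → a ℚS.:* b ℚS.:- c ℚS.:* d ℚS.:=
    a ℚS.:* (b ℚS.:- d) ℚS.:+ d ℚS.:* (a ℚS.:- c)) refl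

------------------------------------------------------------------------
-- Real numbers: Cauchy sequences of rationals, with equality _≃_

record ℝ : Set where
  constructor mkℝ
  field
    seq    : ℕ → ℚ
    cauchy : IsCauchy seq

open ℝ public

infix  4 _≃_ _≤_
infixl 6 _+_
infixl 7 _*_
infix  8 -_

_≃_ : ℝ → ℝ → Set
x ≃ y = ∀ ε → 0ℚ ℚ.< ε → ∃ λ N → ∀ k → N ℕ.≤ k → ℚ.∣ seq x k ℚ.- seq y k ∣ ℚ.< ε

_≤_ : ℝ → ℝ → Set
x ≤ y = ∀ ε → 0ℚ ℚ.< ε → ∃ λ N → ∀ k → N ℕ.≤ k → seq x k ℚ.< seq y k ℚ.+ ε

fromℚ : ℚ → ℝ
fromℚ q = mkℝ (λ _ → q) (const-cauchy q)

fromℤ : ℤ → ℝ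
fromℤ z = fromℚ (z ℚ./ 1)

fromℕ : ℕ → ℝ
fromℕ m = fromℤ (+ m)

_+_ : ℝ → ℝ → ℝ
x + y = mkℝ (λ k → seq x k ℚ.+ seq y k) (+-cauchy (seq x) (seq y) (cauchy x) (cauchy y))

_*_ : ℝ → ℝ → ℝ
x * y = mkℝ (λ k → seq x k ℚ.* seq y k) (*-cauchy (seq x) (seq y) (cauchy x) (cauchy y))

-_ : ℝ → ℝ
- x = mkℝ (λ k → ℚ.- seq x k) (neg-cauchy (seq x) (cauchy x))

abs : ℝ → ℝ
abs x = mkℝ (λ k → ℚ.∣ seq x k ∣) (abs-cauchy (seq x) (cauchy x))

ℝ-rawRing : RawRing 0ℓ 0ℓ
ℝ-rawRing = record
  { Carrier = ℝ
  ; _≈_     = _≃_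
  ; _+_     = _+_
  ; _*_     = _*_
  ; -_      = -_
  ; 0#      = fromℕ 0
  ; 1#      = fromℕ 1
  }

------------------------------------------------------------------------
-- Square roots of natural numbers

-- The integer part of the square root
isqrt : ℕ → ℕ
isqrt zero = 0
isqrt (suc m) with suc (isqrt m) ℕ.* suc (isqrt m) ℕ.≤? suc m
... | yes _ = suc (isqrt m)
... | no  _ = isqrt m

isqrt-lower : ∀ m → isqrt m ℕ.* isqrt m ℕ.≤ m
isqrt-lower zero = ℕ.z≤n
isqrt-lower (suc m) with suc (isqrt m) ℕ.* suc (isqrt m) ℕ.≤? suc m
... | yes p = p
... | no  _ = ℕ.m≤n⇒m≤1+n (isqrt-lower m)

isqrt-upper : ∀ m → m ℕ.< suc (isqrt m) ℕ.* suc (isqrt m)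
isqrt-upper zero = ℕ.s≤s ℕ.z≤n
isqrt-upper (suc m) with suc (isqrt m) ℕ.* suc (isqrt m) ℕ.≤? suc m
... | no ¬p = ℕ.≰⇒> ¬p
... | yes _ = ℕ.<-≤-trans (ℕ.s≤s (isqrt-upper m))
                (ℕ.*-mono-< (ℕ.n<1+n (suc (isqrt m))) (ℕ.n<1+n (suc (isqrt m))))

-- √-seq m k = ⌊ (k + 1) √m ⌋ / (k + 1)
√-seq : ℕ → ℕ → ℚ
√-seq m k = (+ isqrt (m ℕ.* (suc k ℕ.* suc k))) ℚ./ suc k

/-mono-< : ∀ a k b l → a ℕ.* suc l ℕ.< b ℕ.* suc k →
           (+ a) ℚ./ suc k ℚ.< (+ b) ℚ./ suc l
/-mono-< a k b l h = ℚ.toℚᵘ-cancel-< (begin-strict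
  ℚ.toℚᵘ ((+ a) ℚ./ suc k)  ≃⟨ ℚ.toℚᵘ-fromℚᵘ (mkℚᵘ (+ a) k) ⟩
  mkℚᵘ (+ a) k              <⟨ *<* (subst₂ ℤ._<_ (ℤ.pos-* a (suc l)) (ℤ.pos-* b (suc k)) (ℤ.+<+ h)) ⟩
  mkℚᵘ (+ b) l              ≃⟨ ℚ.toℚᵘ-fromℚᵘ (mkℚᵘ (+ b) l) ⟨
  ℚ.toℚᵘ ((+ b) ℚ./ suc l)  ∎)
  where open ℚᵘ.≤-Reasoning

square-cancel-< : ∀ {a b} → a ℕ.* a ℕ.< b ℕ.* b → a ℕ.< b
square-cancel-< {a} {b} h = ℕ.≰⇒> λ b≤a → ℕ.<⇒≱ h (ℕ.*-mono-≤ b≤a b≤a)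

√-seq-step : ∀ m k l →
  √-seq m k ℚ.< (+ suc (isqrt (m ℕ.* (suc l ℕ.* suc l)))) ℚ./ suc l
√-seq-step m k l = /-mono-< a k (suc b) l (square-cancel-< (begin-strict
  a ℕ.* L ℕ.* (a ℕ.* L)              ≡⟨ interchange a L ⟩
  a ℕ.* a ℕ.* (L ℕ.* L)              ≤⟨ ℕ.*-monoˡ-≤ (L ℕ.* L) (isqrt-lower (m ℕ.* (K ℕ.* K))) ⟩
  m ℕ.* (K ℕ.* K) ℕ.* (L ℕ.* L)      ≡⟨ swap m (K ℕ.* K) (L ℕ.* L) ⟩
  m ℕ.* (L ℕ.* L) ℕ.* (K ℕ.* K)      <⟨ ℕ.*-monoˡ-< (K ℕ.* K) (isqrt-upper (m ℕ.* (L ℕ.* L))) ⟩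
  suc b ℕ.* suc b ℕ.* (K ℕ.* K)      ≡⟨ interchange (suc b) K ⟨
  suc b ℕ.* K ℕ.* (suc b ℕ.* K)      ∎))
  where
  open ℕ.≤-Reasoning
  open +-*-Solver
  K = suc k
  L = suc l
  a = isqrt (m ℕ.* (K ℕ.* K))
  b = isqrt (m ℕ.* (L ℕ.* L))
  interchange : ∀ a b → a ℕ.* b ℕ.* (a ℕ.* b) ≡ a ℕ.* a ℕ.* (b ℕ.* b)
  interchange = solve 2 (λ a b → a :* b :* (a :* b) := a :* a :* (b :* b)) refl
  swap : ∀ a b c → a ℕ.* b ℕ.* c ≡ a ℕ.* c ℕ.* b
  swap = solve 3 (λ a b c → a :* b :* c := a :* c :* b) refl

suc-/ : ∀ b l → (+ suc b) ℚ./ suc l ≡ (+ b) ℚ./ suc l ℚ.+ (+ 1) ℚ./ suc l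
suc-/ b l = ℚ.toℚᵘ-injective (begin
  ℚ.toℚᵘ ((+ suc b) ℚ./ suc l)
    ≈⟨ ℚ.toℚᵘ-fromℚᵘ (mkℚᵘ (+ suc b) l) ⟩
  mkℚᵘ (+ suc b) l
    ≈⟨ ℚᵘ.*≡* (eq (+ b) (+ suc l)) ⟩
  mkℚᵘ (+ b) l ℚᵘ.+ mkℚᵘ (+ 1) l
    ≈⟨ ℚᵘ.+-cong (ℚ.toℚᵘ-fromℚᵘ (mkℚᵘ (+ b) l)) (ℚ.toℚᵘ-fromℚᵘ (mkℚᵘ (+ 1) l)) ⟨
  ℚ.toℚᵘ ((+ b) ℚ./ suc l) ℚᵘ.+ ℚ.toℚᵘ ((+ 1) ℚ./ suc l)
    ≈⟨ ℚ.toℚᵘ-homo-+ ((+ b) ℚ./ suc l) ((+ 1) ℚ./ suc l) ⟨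
  ℚ.toℚᵘ ((+ b) ℚ./ suc l ℚ.+ (+ 1) ℚ./ suc l) ∎)
  where
  open ℚᵘ.≃-Reasoning
  eq : ∀ b L → (1ℤ ℤ.+ b) ℤ.* (L ℤ.* L) ≡ (b ℤ.* L ℤ.+ 1ℤ ℤ.* L) ℤ.* L
  eq = solve 2 (λ b L → (con 1ℤ :+ b) :* (L :* L) := (b :* L :+ con 1ℤ :* L) :* L) refl
    where open ℤ.+-*-Solver

archimedean : ∀ ε → 0ℚ ℚ.< ε → ∃ λ N → ∀ k → N ℕ.≤ k → (+ 1) ℚ./ suc k ℚ.< ε
archimedean ε 0<ε = go ε (ℚ.positive 0<ε)
  where
  go : ∀ ε → ℚ.Positive ε → ∃ λ N → ∀ k → N ℕ.≤ k → (+ 1) ℚ./ suc k ℚ.< ε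
  go (ℚ.mkℚ (+ zero) _ _) record { pos = () }
  go (ℚ.mkℚ ℤ.-[1+ _ ] _ _) record { pos = () }
  go ε@(ℚ.mkℚ (+ suc p) d _) _ = suc d , λ k d<k → ℚ.toℚᵘ-cancel-< (begin-strict
    ℚ.toℚᵘ ((+ 1) ℚ./ suc k)  ≃⟨ ℚ.toℚᵘ-fromℚᵘ (mkℚᵘ (+ 1) k) ⟩
    mkℚᵘ (+ 1) k              <⟨ *<* (subst₂ ℤ._<_ (ℤ.pos-* 1 (suc d)) (ℤ.pos-* (suc p) (suc k))
                                   (ℤ.+<+ (bound k d<k))) ⟩
    ℚ.toℚᵘ ε                  ∎)
    where
    open ℚᵘ.≤-Reasoning
    bound : ∀ k → suc d ℕ.≤ k → 1 ℕ.* suc d ℕ.< suc p ℕ.* suc k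
    bound k d<k = subst (ℕ._< suc p ℕ.* suc k) (sym (ℕ.*-identityˡ (suc d)))
      (ℕ.<-≤-trans (ℕ.s≤s d<k) (ℕ.m≤n*m (suc k) (suc p)))

√-cauchy : ∀ m → IsCauchy (√-seq m)
√-cauchy m ε 0<ε = N , λ i j i≥ j≥ →
  abs-bound (√-seq m i) (√-seq m j) (close i j j≥) (close j i i≥)
  where
  open ℚ.≤-Reasoning
  N = archimedean ε 0<ε .proj₁
  cancel : ∀ a b → a ℚ.+ b ℚ.- a ≡ b
  cancel = ℚS.solve 2 (λ a b → a ℚS.:+ b ℚS.:- a ℚS.:= b) refl
  close : ∀ i j → N ℕ.≤ j → √-seq m i ℚ.- √-seq m j ℚ.< ε
  close i j j≥ = begin-strict
    √-seq m i ℚ.- √-seq m j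
      <⟨ ℚ.+-monoˡ-< (ℚ.- √-seq m j) (√-seq-step m i j) ⟩
    (+ suc (isqrt (m ℕ.* (suc j ℕ.* suc j)))) ℚ./ suc j ℚ.- √-seq m j
      ≡⟨ cong (ℚ._- √-seq m j) (suc-/ (isqrt (m ℕ.* (suc j ℕ.* suc j))) j) ⟩
    √-seq m j ℚ.+ (+ 1) ℚ./ suc j ℚ.- √-seq m j
      ≡⟨ cancel (√-seq m j) ((+ 1) ℚ./ suc j) ⟩
    (+ 1) ℚ./ suc j
      <⟨ archimedean ε 0<ε .proj₂ j j≥ ⟩
    ε ∎

√ : ℕ → ℝ
√ m = mkℝ (√-seq m) (√-cauchy m)

------------------------------------------------------------------------
-- Eigenvalues and energy of real matrices

open Polynomial ℝ-rawRing public
  using (Poly; coeff; _≈ₚ_; _+ₚ_; _*ₚ_; -ₚ_; const; X)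
  renaming (rawRing to ℝ[X]-rawRing)
open Sums ℝ-rawRing public using (∑)
open Sums ℝ[X]-rawRing public using () renaming (∏ to ∏ₚ)
open Determinant ℝ[X]-rawRing public using () renaming (det to detₚ)

-- det (X I − M)
charPoly : ∀ {n} → Matrix ℝ n → Poly
charPoly {n} M = detₚ n λ i j → (if does (i Fin.≟ j) then X else []) +ₚ -ₚ const (M i j)

-- ρ lists the eigenvalues of M with algebraic multiplicity:
-- det (X I − M) = ∏ᵢ (X − ρᵢ)
IsSpectrum : ∀ {n} → Matrix ℝ n → Vector ℝ n → Set
IsSpectrum M ρ = charPoly M ≈ₚ ∏ₚ λ i → X +ₚ -ₚ const (ρ i)

-- The energy is a relation, not a function, because no proof that the
-- characteristic polynomial of a symmetric M splits is given here. It
-- determines x up to _≃_, and it is meant for symmetric M only.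
IsEnergy : ∀ {n} → Matrix ℝ n → ℝ → Set
IsEnergy M x = ∃ λ ρ → IsSpectrum M ρ × x ≃ ∑ λ i → abs (ρ i)

------------------------------------------------------------------------
-- Hypergraphs

-- Simple hypergraphs on the vertex set Fin n; the edge set is a list
-- without repetitions.
record Hypergraph (n : ℕ) : Set where
  field
    edges     : List (Subset n)
    distinct  : Unique edges
    no-loops  : ∀ {e} → e ∈ edges → ∣ e ∣ ≢ 1
    antichain : ∀ {e e′} → e ∈ edges → e′ ∈ edges → e ≢ e′ → ¬ (e ⊆ e′)

open Hypergraph public

Uniform : ∀ {n} → ℕ → Hypergraph n → Set
Uniform k H = ∀ {e} → e ∈ edges H → ∣ e ∣ ≡ k

Linear : ∀ {n} → Hypergraph n → Set
Linear H = ∀ {e e′} → e ∈ edges H → e′ ∈ edges H → e ≢ e′ → ∣ e ∩ e′ ∣ ℕ.≤ 1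

codegree : ∀ {n} → Hypergraph n → Fin n → Fin n → ℕ
codegree H i j = length (filter (λ e → (i ∈? e) ×-dec (j ∈? e)) (edges H))

seidel : ∀ {n} → Hypergraph n → Matrix ℝ n
seidel H i j =
  if does (i Fin.≟ j) then fromℕ 0
  else fromℤ (1ℤ ℤ.- + 2 ℤ.* + codegree H i j)

IsSeidelEnergy : ∀ {n} → Hypergraph n → ℝ → Set
IsSeidelEnergy H = IsEnergy (seidel H)

{-# OPTIONS --safe #-}

-- If the monic polynomial det (X I − M) splits with roots ρᵢ, its coefficients
-- of degrees n − 1 and n − 2 determine ∑ ρᵢ², which is therefore tr M². For the
-- Seidel matrix tr M² = ∑_{i≠j} (1 − 2cᵢⱼ)² ≥ n(n − 1), with equality exactly
-- when all co-degrees are at most 1, i.e. when the hypergraph is linear. All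
-- claims then follow from ∑ ρᵢ² ≤ (∑ |ρᵢ|)² ≤ n ∑ ρᵢ².

module Submission where

import Algebra.Definitions.RawSemiring
import Algebra.Properties.CommutativeMonoid.Sum
import Algebra.Properties.Ring
import Algebra.Solver.Ring.NaturalCoefficients.Default
open import Algebra.Bundles using (CommutativeRing)
open import Algebra.Bundles.Raw using (RawRing)
open import Algebra.Structures using (IsCommutativeRing)
open import Data.Bool.Base using (Bool; true; false; if_then_else_)
open import Data.Fin.Base using (Fin; zero; suc; toℕ; punchIn; punchOut)
import Data.Fin.Properties as Fin
open import Data.Fin.Subset using (Subset; inside; outside; _∈_; _∩_; ∣_∣)
import Data.Fin.Subset.Properties as Subset
open import Data.Integer.Base as ℤ using (ℤ; +_; 1ℤ)
import Data.Integer.Properties as ℤ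
import Data.Integer.Solver as ℤ
open import Data.List.Base using (List; []; _∷_; length; map)
open import Data.List.Membership.Propositional using () renaming (_∈_ to _∈ₗ_)
import Data.List.Membership.Propositional.Properties as List
import Data.List.Properties as List
open import Data.List.Relation.Unary.All using (_∷_)
open import Data.List.Relation.Unary.AllPairs using (_∷_)
open import Data.List.Relation.Unary.Any using (here; there)
open import Data.List.Relation.Unary.Unique.Propositional using (Unique)
import Data.List.Relation.Unary.Unique.Propositional.Properties as Unique
open import Data.Nat.Base as ℕ using (ℕ; zero; suc; 2+; _∸_; z≤n; s≤s)
import Data.Nat.Properties as ℕ
open import Data.Nat.Solver using (module +-*-Solver)
open import Data.Product.Base using (_×_; _,_; proj₁; proj₂; ∃; ∃₂; swap)
open import Data.Rational.Base as ℚ using (ℚ; 0ℚ; 1ℚ; ½)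
import Data.Rational.Properties as ℚ
import Data.Rational.Solver as ℚ
open import Data.Rational.Unnormalised.Base as ℚᵘ using (mkℚᵘ; *≤*; *≡*)
import Data.Rational.Unnormalised.Properties as ℚᵘ
open import Data.Sum.Base using (inj₁; inj₂)
open import Data.Vec.Base using (_∷_; here; there)
open import Data.Vec.Functional using (Vector)
open import Function.Base using (_∘_)
open import Level using (0ℓ)
open import Relation.Binary.Bundles using (Preorder; Setoid)
open import Relation.Binary.PropositionalEquality as ≡ using (_≡_; _≢_)
import Relation.Binary.Reasoning.Preorder
import Relation.Binary.Reasoning.Setoid
open import Relation.Binary.Structures using (IsEquivalence)
open import Relation.Nullary using (Dec; yes; no; does; contradiction)
open import Relation.Nullary.Decidable using (_×-dec_; dec-true; dec-false)

import Defs

-- Laplace expansion destroys the shape X I - M: a minor of it has lost diagonal entries.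
-- Determinants are therefore studied for matrices in which Boolean flags say which entries carry X,
-- a class closed under taking minors. A column without flags lowers the degree, which leaves few
-- terms in the three leading coefficients. As far as these coefficients go, expansion along the
-- first row obeys the recursion p′ = (X - m) p of a product of linear factors, save for a
-- correction -∑ M₀ⱼMⱼ₀ (over j > 0) two degrees below the top. Newton's identity follows this
-- recursion for both polynomials, with no eigenvectors and no spectral theorem. The trace of M² is
-- the image of a natural number, so the comparison with n(n - 1) and its equality case are settled
-- in ℕ. The inequalities between sums over the ρᵢ hold at every index of the rational sequences, so
-- no limit argument enters there.

open Algebra.Properties.CommutativeMonoid.Sum ℕ.+-0-commutativeMonoid using () renaming (sum to sumℕ)

-- The double sum over i ≠ j of w i j, for symmetric w.
offDiagonalSum : ∀ n → (Fin n → Fin n → ℕ) → ℕ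
offDiagonalSum zero    w = 0
offDiagonalSum (suc n) w = let r = sumℕ λ j → w zero (suc j) in
  r ℕ.+ r ℕ.+ offDiagonalSum n λ i j → w (suc i) (suc j)

-- Characteristic polynomials over a commutative ring

-- Parametrised by the raw ring so that, at the reals, the polynomials are
-- syntactically those of Defs: comparing them by unfolding is infeasible.
module CharacteristicPolynomial (R : RawRing 0ℓ 0ℓ)
  (isCommutativeRing : IsCommutativeRing (RawRing._≈_ R) (RawRing._+_ R) (RawRing._*_ R)
    (RawRing.-_ R) (RawRing.0# R) (RawRing.1# R)) where

  commutativeRing : CommutativeRing 0ℓ 0ℓ
  commutativeRing = record { isCommutativeRing = isCommutativeRing }

  open CommutativeRing commutativeRing hiding (zero; rawRing; isCommutativeRing)
  open Algebra.Properties.Ring ring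
  open Algebra.Properties.CommutativeMonoid.Sum +-commutativeMonoid using (sum; sum-cong-≋; sum-replicate-zero)
  open Relation.Binary.Reasoning.Setoid setoid
  open Defs.Polynomial R renaming (rawRing to R[X])
  open Defs.Determinant R[X] using (det; minor)
  open Defs.Sums R[X] using () renaming (∑ to ∑ₚ; ∏ to ∏ₚ)
  open Algebra.Definitions.RawSemiring (RawRing.rawSemiring R[X]) using () renaming (_^_ to _^ₚ_)
  module S = Algebra.Solver.Ring.NaturalCoefficients.Default commutativeSemiring

  sum-cong : ∀ n {f g : Vector Carrier n} → (∀ i → f i ≈ g i) → sum f ≈ sum g
  sum-cong n {f} {g} f≈g = sum-cong-≋ {n} {f} {g} f≈g

  sum-zero : ∀ n {f : Vector Carrier n} → (∀ i → f i ≈ 0#) → sum f ≈ 0#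
  sum-zero n f≈0 = trans (sum-cong n f≈0) (sum-replicate-zero n)

  *-zero : ∀ x {y} → y ≈ 0# → x * y ≈ 0#
  *-zero x y≈0 = trans (*-congˡ y≈0) (zeroʳ x)

  -- Coefficients of sums and products; signs of the expansion

  coeff-+ₚ : ∀ p q k → coeff (p +ₚ q) k ≈ coeff p k + coeff q k
  coeff-+ₚ []      q       k       = sym (+-identityˡ _)
  coeff-+ₚ (a ∷ p) []      k       = sym (+-identityʳ _)
  coeff-+ₚ (a ∷ p) (b ∷ q) zero    = refl
  coeff-+ₚ (a ∷ p) (b ∷ q) (suc k) = coeff-+ₚ p q k

  coeff-map : ∀ a p k → coeff (map (a *_) p) k ≈ a * coeff p k
  coeff-map a []      k       = sym (zeroʳ a)
  coeff-map a (b ∷ p) zero    = refl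
  coeff-map a (b ∷ p) (suc k) = coeff-map a p k

  coeff-∑ : ∀ {n} (p : Fin n → Poly) k → coeff (∑ₚ p) k ≈ sum λ j → coeff (p j) k
  coeff-∑ {zero}  p k = refl
  coeff-∑ {suc n} p k = trans (coeff-+ₚ (p zero) _ k) (+-congˡ (coeff-∑ (p ∘ suc) k))

  coeff-∷-* : ∀ a p q k → coeff ((a ∷ p) *ₚ q) k ≈ a * coeff q k + coeff (0# ∷ p *ₚ q) k
  coeff-∷-* a p q k = trans (coeff-+ₚ (map (a *_) q) _ k) (+-congʳ (coeff-map a q k))

  coeff-const-* : ∀ a q k → coeff (const a *ₚ q) k ≈ a * coeff q k
  coeff-const-* a q k = begin
    coeff (const a *ₚ q) k           ≈⟨ coeff-∷-* a [] q k ⟩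
    a * coeff q k + coeff (const 0#) k ≈⟨ +-congˡ (0∷[] k) ⟩
    a * coeff q k + 0#               ≈⟨ +-identityʳ _ ⟩
    a * coeff q k                    ∎
    where
    0∷[] : ∀ k → coeff (const 0#) k ≈ 0#
    0∷[] zero    = refl
    0∷[] (suc k) = refl

  -- The summand `0#` is what `_*ₚ_` adds when two constants are multiplied; keeping it makes
  -- `sign-const` an equality of lists, usable for rewriting under `coeff`.
  sign : ℕ → Carrier
  sign zero    = 1#
  sign (suc j) = - 1# * sign j + 0#

  sign-const : ∀ j → (-ₚ const 1#) ^ₚ j ≡ const (sign j)
  sign-const zero    = ≡.refl
  sign-const (suc j) = ≡.cong ((-ₚ const 1#) *ₚ_) (sign-const j)

  sign-suc : ∀ j → sign (suc j) ≈ - sign j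
  sign-suc j = trans (+-identityʳ _) (-1*x≈-x (sign j))

  -x*-y≈x*y : ∀ x y → (- x) * (- y) ≈ x * y
  -x*-y≈x*y x y = begin
    (- x) * (- y)    ≈⟨ -‿distribˡ-* x (- y) ⟨
    - (x * - y)      ≈⟨ -‿cong (sym (-‿distribʳ-* x y)) ⟩
    - (- (x * y))    ≈⟨ -‿involutive (x * y) ⟩
    x * y            ∎

  sign² : ∀ j → sign j * sign j ≈ 1#
  sign² zero    = *-identityˡ 1#
  sign² (suc j) = begin
    sign (suc j) * sign (suc j) ≈⟨ *-cong (sign-suc j) (sign-suc j) ⟩
    (- sign j) * (- sign j)     ≈⟨ -x*-y≈x*y _ _ ⟩
    sign j * sign j             ≈⟨ sign² j ⟩
    1#                          ∎

  -- Determinants with entries X - m or -m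

  entry : Bool → Carrier → Poly
  entry d m = (if d then X else []) +ₚ -ₚ const m

  coeff-true-* : ∀ m q k → coeff (entry true m *ₚ q) k ≈ coeff (0# ∷ q) k + - m * coeff q k
  coeff-true-* m q k = begin
    coeff (entry true m *ₚ q) k
      ≈⟨ coeff-∷-* (0# + - m) (const 1#) q k ⟩
    (0# + - m) * coeff q k + coeff (0# ∷ const 1# *ₚ q) k
      ≈⟨ +-cong (*-congʳ (+-identityˡ (- m))) (shift k) ⟩
    - m * coeff q k + coeff (0# ∷ q) k
      ≈⟨ +-comm _ _ ⟩
    coeff (0# ∷ q) k + - m * coeff q k ∎
    where
    shift : ∀ k → coeff (0# ∷ const 1# *ₚ q) k ≈ coeff (0# ∷ q) k
    shift zero    = refl
    shift (suc k) = trans (coeff-const-* 1# q k) (*-identityˡ _)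

  Flags : ℕ → Set
  Flags n = Fin n → Fin n → Bool

  -- The flags are independent of the indices because the minors met below carry their X's off the
  -- diagonal, and some of their rows or columns carry none.
  χ : ∀ n → Flags n → (Fin n → Fin n → Carrier) → Poly
  χ n D M = det n λ i l → entry (D i l) (M i l)

  remove : ∀ {A : Set} {n} → (Fin (suc n) → Fin (suc n) → A) → Fin (suc n) → Fin n → Fin n → A
  remove M j i l = M (suc i) (punchIn j l)

  module _ {n} (D : Flags (suc n)) (M : Fin (suc n) → Fin (suc n) → Carrier) where

    subχ : Fin (suc n) → Poly
    subχ j = χ n (remove D j) (remove M j)

    term : Fin (suc n) → ℕ → Carrier
    term j k = coeff (entry (D zero j) (M zero j) *ₚ subχ j) k

    term-true : ∀ j k → D zero j ≡ true → term j k ≈ coeff (0# ∷ subχ j) k + - M zero j * coeff (subχ j) k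
    term-true j k d rewrite d = coeff-true-* (M zero j) (subχ j) k

    term-false : ∀ j k → D zero j ≡ false → term j k ≈ - M zero j * coeff (subχ j) k
    term-false j k d rewrite d = coeff-const-* (- M zero j) (subχ j) k

    laplace : ∀ k → coeff (χ (suc n) D M) k ≈ sum λ j → sign (toℕ j) * term j k
    laplace k = trans (coeff-∑ (λ j → (-ₚ const 1#) ^ₚ toℕ j *ₚ (entry (D zero j) (M zero j) *ₚ subχ j)) k) (sum-cong (suc n) λ j → begin
      coeff ((-ₚ const 1#) ^ₚ toℕ j *ₚ (entry (D zero j) (M zero j) *ₚ subχ j)) k
        ≡⟨ ≡.cong (λ p → coeff (p *ₚ (entry (D zero j) (M zero j) *ₚ subχ j)) k) (sign-const (toℕ j)) ⟩
      coeff (const (sign (toℕ j)) *ₚ (entry (D zero j) (M zero j) *ₚ subχ j)) k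
        ≈⟨ coeff-const-* (sign (toℕ j)) (entry (D zero j) (M zero j) *ₚ subχ j) k ⟩
      sign (toℕ j) * term j k ∎)

    term-zero : ∀ j k → coeff (0# ∷ subχ j) k ≈ 0# → coeff (subχ j) k ≈ 0# → term j k ≈ 0#
    term-zero j k z z′ = by (D zero j) ≡.refl
      where
      const-zero : - M zero j * coeff (subχ j) k ≈ 0#
      const-zero = trans (*-congˡ z′) (zeroʳ _)
      by : ∀ d → D zero j ≡ d → term j k ≈ 0#
      by true  d = trans (term-true j k d) (trans (+-cong z const-zero) (+-identityʳ 0#))
      by false d = trans (term-false j k d) const-zero

    term-false-zero : ∀ j k → D zero j ≡ false → coeff (subχ j) k ≈ 0# → term j k ≈ 0#
    term-false-zero j k d z = trans (term-false j k d) (trans (*-congˡ z) (zeroʳ _))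

    laplace-zero : ∀ k → (∀ j → term j k ≈ 0#) → coeff (χ (suc n) D M) k ≈ 0#
    laplace-zero k z = trans (laplace k) (sum-zero (suc n) λ j → *-zero (sign (toℕ j)) (z j))

  -- Degrees and leading coefficients

  degree-≤ : ∀ n D M k → n ℕ.< k → coeff (χ n D M) k ≈ 0#
  degree-≤ zero    D M (suc k) _         = refl
  degree-≤ (suc n) D M (suc k) (s≤s n<k) = laplace-zero D M (suc k) λ j →
    term-zero D M j (suc k) (degree-≤ n (remove D j) (remove M j) k n<k)
      (degree-≤ n (remove D j) (remove M j) (suc k) (ℕ.m<n⇒m<1+n n<k))

  -- A column without X costs one degree. Expanding at that column contributes a constant times a
  -- minor of degree at most n - 1 (for size n); expanding at any other column contributes at most
  -- one X, and the minor still contains the bad column, so induction applies.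
  degree-< : ∀ n D M c → (∀ i → D i c ≡ false) → ∀ k → n ℕ.≤ k → coeff (χ n D M) k ≈ 0#
  degree-< (suc n) D M c D≡f (suc k) (s≤s n≤k) = laplace-zero D M (suc k) vanish
    where
    vanish : ∀ j → term D M j (suc k) ≈ 0#
    vanish j with j Fin.≟ c
    ... | yes ≡.refl = term-false-zero D M j (suc k) (D≡f zero)
      (degree-≤ n (remove D j) (remove M j) (suc k) (s≤s n≤k))
    ... | no  j≢c    = term-zero D M j (suc k) (lower k n≤k) (lower (suc k) (ℕ.m≤n⇒m≤1+n n≤k))
      where
      lower : ∀ k → n ℕ.≤ k → coeff (subχ D M j) k ≈ 0#
      lower = degree-< n (remove D j) (remove M j) (punchOut j≢c) λ i → ≡.trans (≡.cong (D (suc i)) (Fin.punchIn-punchOut j≢c)) (D≡f (suc i))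

  δ : ∀ {n} → Flags n
  δ i j = does (i Fin.≟ j)

  IsDiagonal : ∀ {n} → Flags n → Set
  IsDiagonal D = ∀ i j → D i j ≡ δ i j

  -- In row 0 only column 0 carries X. The other columns multiply a constant by a minor too small to
  -- reach the top degree.
  top-coeff : ∀ n D M → IsDiagonal D → coeff (χ n D M) n ≈ 1#
  top-coeff zero    D M _  = refl
  top-coeff (suc n) D M D≡ = begin
    coeff (χ (suc n) D M) (suc n)
      ≈⟨ laplace D M (suc n) ⟩
    1# * term D M zero (suc n) + sum (λ j → sign (suc (toℕ j)) * term D M (suc j) (suc n))
      ≈⟨ +-cong (trans (*-identityˡ _) (term-true D M zero (suc n) (D≡ zero zero)))
           (sum-zero n λ j → *-zero (sign (suc (toℕ j))) (term-false-zero D M (suc j) (suc n) (D≡ zero (suc j))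
             (degree-≤ n (remove D (suc j)) (remove M (suc j)) (suc n) ℕ.≤-refl))) ⟩
    (coeff p n + - M zero zero * coeff p (suc n)) + 0#
      ≈⟨ trans (+-identityʳ _) (+-cong (top-coeff n (remove D zero) (remove M zero) λ i j → D≡ (suc i) (suc j))
           (*-zero (- M zero zero) (degree-≤ n (remove D zero) (remove M zero) (suc n) ℕ.≤-refl))) ⟩
    1# + 0#
      ≈⟨ +-identityʳ 1# ⟩
    1# ∎
    where p = subχ D M zero

  -- D is the pattern left by an n × n diagonal after removing row 0 and column j + 1.
  minor-coeff : ∀ n D M j → (∀ i → D i zero ≡ false) → (∀ i l → D i (suc l) ≡ δ i (punchIn j l)) →
    coeff (χ (suc n) D M) n ≈ sign (toℕ j) * - M j zero
  minor-coeff n D M zero D0 Ds = begin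
    coeff (χ (suc n) D M) n
      ≈⟨ laplace D M n ⟩
    1# * term D M zero n + sum (λ l → sign (suc (toℕ l)) * term D M (suc l) n)
      ≈⟨ +-cong (*-congˡ (trans (term-false D M zero n (D0 zero))
           (trans (*-congˡ (top-coeff n (remove D zero) (remove M zero) λ i l → Ds (suc i) l)) (*-identityʳ _))))
         (sum-zero n λ l → *-zero (sign (suc (toℕ l))) (term-false-zero D M (suc l) n (Ds zero l)
           (later n D M l D0))) ⟩
    1# * - M zero zero + 0#
      ≈⟨ +-identityʳ _ ⟩
    1# * - M zero zero ∎
    where
    later : ∀ n D M (l : Fin n) → (∀ i → D i zero ≡ false) → coeff (subχ D M (suc l)) n ≈ 0#
    later (suc n) D M l D0 = degree-< (suc n) (remove D (suc l)) (remove M (suc l)) zero (λ i → D0 (suc i)) (suc n) ℕ.≤-refl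
  minor-coeff (suc n) D M (suc j) D0 Ds = begin
    coeff (χ (2+ n) D M) (suc n)
      ≈⟨ laplace D M (suc n) ⟩
    1# * term D M zero (suc n) + (sign 1 * term D M (suc zero) (suc n) + sum (λ l → sign (2+ (toℕ l)) * term D M (suc (suc l)) (suc n)))
      -- Row 0 has its X in column 1 alone, and removing that column leaves the same pattern for
      -- `j`. Every other choice takes a constant from row 0 and leaves a minor with an X-free first
      -- column: old column 1 without its X if column 0 is removed, and column 0 otherwise.
      ≈⟨ +-cong (*-zero 1# (term-false-zero D M zero (suc n) (D0 zero)
             (degree-< (suc n) (remove D zero) (remove M zero) zero (λ i → Ds (suc i) zero) (suc n) ℕ.≤-refl)))
           (+-cong (*-cong (sign-suc 0) second) (sum-zero n λ l → *-zero (sign (2+ (toℕ l)))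
              (term-false-zero D M (suc (suc l)) (suc n) (Ds zero (suc l))
                 (degree-< (suc n) (remove D (suc (suc l))) (remove M (suc (suc l))) zero (λ i → D0 (suc i)) (suc n) ℕ.≤-refl)))) ⟩
    0# + (- 1# * (sign (toℕ j) * - M (suc j) zero) + 0#)
      ≈⟨ trans (+-identityˡ _) (+-identityʳ _) ⟩
    - 1# * (sign (toℕ j) * - M (suc j) zero)
      ≈⟨ *-assoc _ _ _ ⟨
    (- 1# * sign (toℕ j)) * - M (suc j) zero
      ≈⟨ *-congʳ (+-identityʳ _) ⟨
    sign (suc (toℕ j)) * - M (suc j) zero ∎
    where
    p = subχ D M (suc zero)
    second : term D M (suc zero) (suc n) ≈ sign (toℕ j) * - M (suc j) zero
    second = begin
      term D M (suc zero) (suc n)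
        ≈⟨ term-true D M (suc zero) (suc n) (Ds zero zero) ⟩
      coeff p n + - M zero (suc zero) * coeff p (suc n)
        ≈⟨ +-cong (minor-coeff n (remove D (suc zero)) (remove M (suc zero)) j (λ i → D0 (suc i)) (λ i l → Ds (suc i) (suc l)))
             (*-zero (- M zero (suc zero)) (degree-< (suc n) (remove D (suc zero)) (remove M (suc zero)) zero (λ i → D0 (suc i)) (suc n) ℕ.≤-refl)) ⟩
      sign (toℕ j) * - M (suc j) zero + 0#
        ≈⟨ +-identityʳ _ ⟩
      sign (toℕ j) * - M (suc j) zero ∎

  -- If p has the roots r₁, …, rₙ, then Q is r₁² + … + rₙ², as Newton's
  -- identity e₁² = 2 e₂ + ∑ rᵢ² reads it off the leading coefficients of p.
  record MonicWithPowerSum (n : ℕ) (p : Poly) (Q : Carrier) : Set where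
    field
      bounded : ∀ k → n ℕ.< k → coeff p k ≈ 0#
      monic   : coeff p n ≈ 1#
      -- Prepending `0#` multiplies by X, so coefficients n - 1 and n - 2 are read as 0 when the
      -- index is negative. This e₁ is minus the sum of the roots; only its square enters.
      newton  : let e₁ = coeff (0# ∷ p) n ; e₂ = coeff (0# ∷ 0# ∷ p) n in
                e₁ * e₁ ≈ e₂ + e₂ + Q

  open MonicWithPowerSum

  -- Here p′ agrees with (X - m) p from degree n upward, and differs from it by t at degree n - 1.
  -- Hence e₁′ = e₁ - m and e₂′ = e₂ - m e₁ + t, so e₁² - 2 e₂ grows by m² - 2t. The element s
  -- stands for -t, which keeps subtraction out of the semiring solver.
  extend : ∀ {n p Q} p′ m t s → MonicWithPowerSum n p Q →
    (∀ k → suc n ℕ.≤ k → coeff p′ k ≈ coeff (0# ∷ p) k + - m * coeff p k) →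
    coeff p′ n ≈ coeff (0# ∷ p) n + - m * coeff p n →
    coeff (0# ∷ p′) n ≈ coeff (0# ∷ 0# ∷ p) n + - m * coeff (0# ∷ p) n + t →
    t + s ≈ 0# →
    MonicWithPowerSum (suc n) p′ (m * m + (s + s) + Q)
  extend {n} {p} {Q} p′ m t s P top sub₁ sub₂ t+s≈0 = record
    { bounded = λ { (suc k) (s≤s n<k) → begin
        coeff p′ (suc k)                       ≈⟨ top (suc k) (s≤s (ℕ.<⇒≤ n<k)) ⟩
        coeff p k + - m * coeff p (suc k)      ≈⟨ +-cong (bounded P k n<k) (*-congˡ (bounded P (suc k) (ℕ.m<n⇒m<1+n n<k))) ⟩
        0# + - m * 0#                          ≈⟨ trans (+-identityˡ _) (zeroʳ _) ⟩
        0#                                     ∎ }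
    ; monic = begin
        coeff p′ (suc n)                       ≈⟨ top (suc n) ℕ.≤-refl ⟩
        coeff p n + - m * coeff p (suc n)      ≈⟨ +-cong (monic P) (*-congˡ (bounded P (suc n) ℕ.≤-refl)) ⟩
        1# + - m * 0#                          ≈⟨ trans (+-congˡ (zeroʳ _)) (+-identityʳ _) ⟩
        1#                                     ∎
    ; newton = begin
        coeff p′ n * coeff p′ n
          ≈⟨ *-cong e₁′ e₁′ ⟩
        (e₁ + - m) * (e₁ + - m)
          ≈⟨ S.solve 2 (λ e x → (e S.:+ x) S.:* (e S.:+ x) S.:= (e S.:* e) S.:+ (x S.:* e S.:+ x S.:* e S.:+ x S.:* x)) refl e₁ (- m) ⟩
        e₁ * e₁ + (- m * e₁ + - m * e₁ + - m * - m)
          ≈⟨ +-cong (newton P) (+-congˡ (-x*-y≈x*y m m)) ⟩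
        (e₂ + e₂ + Q) + (- m * e₁ + - m * e₁ + m * m)
          ≈⟨ S.solve 4 (λ e q y z → (e S.:+ e S.:+ q) S.:+ (y S.:+ y S.:+ z) S.:= (e S.:+ y S.:+ (e S.:+ y)) S.:+ (z S.:+ q)) refl e₂ Q (- m * e₁) (m * m) ⟩
        (e₂ + - m * e₁ + (e₂ + - m * e₁)) + (m * m + Q)
          ≈⟨ +-congˡ (trans (+-congˡ (sym (+-identityˡ Q))) (+-congˡ (+-congʳ (sym (trans (+-cong t+s≈0 t+s≈0) (+-identityʳ 0#)))))) ⟩
        (e₂ + - m * e₁ + (e₂ + - m * e₁)) + (m * m + ((t + s) + (t + s) + Q))
          ≈⟨ S.solve 5 (λ a z q t s → (a S.:+ a) S.:+ (z S.:+ ((t S.:+ s) S.:+ (t S.:+ s) S.:+ q)) S.:= (a S.:+ t S.:+ (a S.:+ t)) S.:+ (z S.:+ (s S.:+ s) S.:+ q)) refl (e₂ + - m * e₁) (m * m) Q t s ⟩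
        (e₂ + - m * e₁ + t + (e₂ + - m * e₁ + t)) + (m * m + (s + s) + Q)
          ≈⟨ +-congʳ (+-cong sub₂ sub₂) ⟨
        coeff (0# ∷ p′) n + coeff (0# ∷ p′) n + (m * m + (s + s) + Q) ∎
    }
    where
    e₁ = coeff (0# ∷ p) n
    e₂ = coeff (0# ∷ 0# ∷ p) n
    e₁′ : coeff p′ n ≈ e₁ + - m
    e₁′ = trans sub₁ (+-congˡ (trans (*-congˡ (monic P)) (*-identityʳ _)))

  empty-power-sum : MonicWithPowerSum 0 (const 1#) 0#
  empty-power-sum = record
    { bounded = λ { (suc k) _ → refl }
    ; monic   = refl
    ; newton  = trans (zeroˡ 0#) (sym (trans (+-identityʳ _) (+-identityʳ 0#)))
    }

  -- Newton's identity for the two polynomials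

  sum-squares : ∀ {n} → Vector Carrier n → Carrier
  sum-squares ρ = sum λ i → ρ i * ρ i

  -- This is tr M² = ∑ MᵢⱼMⱼᵢ, with the first row and column peeled off together so that each layer
  -- is one application of `extend`.
  trace² : ∀ n → (Fin n → Fin n → Carrier) → Carrier
  trace² zero    M = 0#
  trace² (suc n) M =
    let s = sum λ j → M zero (suc j) * M (suc j) zero in
    M zero zero * M zero zero + (s + s) + trace² n λ i j → M (suc i) (suc j)

  coeff-0∷-true-* : ∀ m q k → coeff (0# ∷ entry true m *ₚ q) k ≈ coeff (0# ∷ 0# ∷ q) k + - m * coeff (0# ∷ q) k
  coeff-0∷-true-* m q zero    = sym (trans (+-congˡ (zeroʳ _)) (+-identityʳ _))
  coeff-0∷-true-* m q (suc k) = coeff-true-* m q k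

  product-power-sum : ∀ n (ρ : Vector Carrier n) →
    MonicWithPowerSum n (∏ₚ λ i → X +ₚ -ₚ const (ρ i)) (sum-squares ρ)
  product-power-sum zero    ρ = empty-power-sum
  product-power-sum (suc n) ρ = record
    { bounded = bounded P
    ; monic   = monic P
    ; newton  = trans (newton P) (+-congˡ (+-congʳ (trans (+-congˡ (+-identityʳ 0#)) (+-identityʳ _))))
    }
    where
    q = ∏ₚ λ i → X +ₚ -ₚ const (ρ (suc i))
    P : MonicWithPowerSum (suc n) _ (ρ zero * ρ zero + (0# + 0#) + sum-squares (ρ ∘ suc))
    -- The product is (X - ρ₀) q exactly, so the correction is zero.
    P = extend (entry true (ρ zero) *ₚ q) (ρ zero) 0# 0# (product-power-sum n (ρ ∘ suc))
      (λ k _ → coeff-true-* (ρ zero) q k)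
      (coeff-true-* (ρ zero) q n)
      (trans (coeff-0∷-true-* (ρ zero) q n) (sym (+-identityʳ _)))
      (+-identityʳ 0#)

  sum-neg : ∀ {n} (f : Vector Carrier n) → sum (λ i → - f i) + sum f ≈ 0#
  sum-neg {zero}  f = +-identityʳ 0#
  sum-neg {suc n} f = begin
    (- f zero + sum (λ i → - f (suc i))) + (f zero + sum (f ∘ suc))
      ≈⟨ S.solve 4 (λ a b c d → (a S.:+ b) S.:+ (c S.:+ d) S.:= (a S.:+ c) S.:+ (b S.:+ d)) refl _ _ _ _ ⟩
    (- f zero + f zero) + (sum (λ i → - f (suc i)) + sum (f ∘ suc))
      ≈⟨ +-cong (-‿inverseˡ _) (sum-neg (f ∘ suc)) ⟩
    0# + 0#
      ≈⟨ +-identityʳ 0# ⟩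
    0# ∎

  -- Column 0 of the expansion gives (X - M₀₀) times the characteristic polynomial of the lower
  -- right block. Column j + 1 gives a constant times a minor whose first column is X-free; it first
  -- matters two degrees below the top, where `minor-coeff` evaluates it.
  characteristic-power-sum : ∀ n D M → IsDiagonal D →
    MonicWithPowerSum n (χ n D M) (trace² n M)
  characteristic-power-sum zero    D M _  = empty-power-sum
  characteristic-power-sum (suc n) D M D≡ = extend (χ (suc n) D M) (M zero zero) t s
    (characteristic-power-sum n (remove D zero) (remove M zero) λ i j → D≡ (suc i) (suc j))
    (λ k n<k → diagonal k λ j → degree-≤ n (remove D (suc j)) (remove M (suc j)) k n<k)
    (diagonal n λ j → off n D M D≡ j)
    (sub₂ n D M D≡)
    (sum-neg λ j → M zero (suc j) * M (suc j) zero)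
    where
    s = sum λ j → M zero (suc j) * M (suc j) zero
    t = sum λ j → - (M zero (suc j) * M (suc j) zero)
    off : ∀ n D M → IsDiagonal D → ∀ (j : Fin n) → coeff (subχ D M (suc j)) n ≈ 0#
    off (suc n) D M D≡ j = degree-< (suc n) (remove D (suc j)) (remove M (suc j)) zero (λ i → D≡ (suc i) zero) (suc n) ℕ.≤-refl
    diagonal : ∀ k → (∀ j → coeff (subχ D M (suc j)) k ≈ 0#) →
      coeff (χ (suc n) D M) k ≈ coeff (0# ∷ subχ D M zero) k + - M zero zero * coeff (subχ D M zero) k
    diagonal k z = begin
      coeff (χ (suc n) D M) k
        ≈⟨ laplace D M k ⟩
      1# * term D M zero k + sum (λ j → sign (suc (toℕ j)) * term D M (suc j) k)
        ≈⟨ +-cong (trans (*-identityˡ _) (term-true D M zero k (D≡ zero zero)))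
             (sum-zero n λ j → *-zero (sign (suc (toℕ j))) (term-false-zero D M (suc j) k (D≡ zero (suc j)) (z j))) ⟩
      _ + 0#
        ≈⟨ +-identityʳ _ ⟩
      _ ∎
    sub₂ : ∀ n (D : Flags (suc n)) M → IsDiagonal D → coeff (0# ∷ χ (suc n) D M) n ≈
      coeff (0# ∷ 0# ∷ subχ D M zero) n + - M zero zero * coeff (0# ∷ subχ D M zero) n
      + sum λ j → - (M zero (suc j) * M (suc j) zero)
    sub₂ zero    D M D≡ = sym (trans (+-identityʳ _) (trans (+-congˡ (zeroʳ _)) (+-identityʳ _)))
    sub₂ (suc n) D M D≡ = trans (laplace D M n)
      (+-cong (trans (*-identityˡ _) (term-true D M zero n (D≡ zero zero))) (sum-cong (suc n) λ j → begin
        sign (suc (toℕ j)) * term D M (suc j) n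
          ≈⟨ *-cong (sign-suc (toℕ j)) (term-false D M (suc j) n (D≡ zero (suc j))) ⟩
        (- sign (toℕ j)) * (- M zero (suc j) * coeff (subχ D M (suc j)) n)
          ≈⟨ *-congˡ (*-congˡ (minor-coeff n (remove D (suc j)) (remove M (suc j)) j (λ i → D≡ (suc i) zero) (λ i l → D≡ (suc i) (suc (punchIn j l))))) ⟩
        (- sign (toℕ j)) * (- M zero (suc j) * (sign (toℕ j) * - M (suc j) zero))
          ≈⟨ S.solve 4 (λ a b c d → a S.:* (b S.:* (c S.:* d)) S.:= (a S.:* c) S.:* (b S.:* d)) refl _ _ _ _ ⟩
        ((- sign (toℕ j)) * sign (toℕ j)) * (- M zero (suc j) * - M (suc j) zero)
          -- The expansion sign is the negative of the sign found in the minor, so together they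
          -- give -1, while the minus signs of the two entries cancel.
          ≈⟨ *-cong (trans (sym (-‿distribˡ-* _ _)) (-‿cong (sign² (toℕ j)))) (-x*-y≈x*y _ _) ⟩
        - 1# * (M zero (suc j) * M (suc j) zero)
          ≈⟨ -1*x≈-x _ ⟩
        - (M zero (suc j) * M (suc j) zero) ∎))

  coeff-0∷-cong : ∀ {p q} → p ≈ₚ q → (0# ∷ p) ≈ₚ (0# ∷ q)
  coeff-0∷-cong p≈q zero    = refl
  coeff-0∷-cong p≈q (suc k) = p≈q k

  power-sum-unique : ∀ {n p q P Q} → p ≈ₚ q → MonicWithPowerSum n p P → MonicWithPowerSum n q Q → P ≈ Q
  power-sum-unique {n} {p} {q} {P} {Q} p≈q p-sum q-sum = +-cancelˡ (e₂ q + e₂ q) P Q (begin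
    e₂ q + e₂ q + P   ≈⟨ +-congʳ (+-cong e₂≈ e₂≈) ⟨
    e₂ p + e₂ p + P   ≈⟨ newton p-sum ⟨
    e₁ p * e₁ p       ≈⟨ *-cong e₁≈ e₁≈ ⟩
    e₁ q * e₁ q       ≈⟨ newton q-sum ⟩
    e₂ q + e₂ q + Q   ∎)
    where
    e₁ = λ p → coeff (0# ∷ p) n
    e₂ = λ p → coeff (0# ∷ 0# ∷ p) n
    e₁≈ = coeff-0∷-cong p≈q n
    e₂≈ = coeff-0∷-cong (coeff-0∷-cong p≈q) n

  -- At the flags `δ`, `χ` unfolds to det (X I - M); over the reals the hypothesis is therefore
  -- `IsSpectrum` itself.
  sum-squares≈trace² : ∀ n M (ρ : Vector Carrier n) →
    χ n δ M ≈ₚ (∏ₚ λ i → X +ₚ -ₚ const (ρ i)) → sum-squares ρ ≈ trace² n M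
  sum-squares≈trace² n M ρ spectrum = sym (power-sum-unique spectrum
    (characteristic-power-sum n δ M λ i j → ≡.refl) (product-power-sum n ρ))

  module _ (f : ℕ → Carrier) (f-0 : f 0 ≈ 0#) (f-+ : ∀ a b → f (a ℕ.+ b) ≈ f a + f b) where

    sum-hom : ∀ {n} (w : Vector ℕ n) → f (sumℕ w) ≈ sum (f ∘ w)
    sum-hom {zero}  w = f-0
    sum-hom {suc n} w = trans (f-+ (w zero) (sumℕ (w ∘ suc))) (+-congˡ (sum-hom (w ∘ suc)))

    -- Meant for the embedding of ℕ into the reals: once every product MᵢⱼMⱼᵢ off the diagonal comes
    -- from a natural number, so does the whole trace.
    trace²-hom : ∀ n M (w : Fin n → Fin n → ℕ) → (∀ i → M i i ≈ 0#) →
      (∀ i j → i ≢ j → M i j * M j i ≈ f (w i j)) → trace² n M ≈ f (offDiagonalSum n w)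
    trace²-hom zero    M w diag off = sym f-0
    trace²-hom (suc n) M w diag off = begin
      M zero zero * M zero zero + (s + s) + trace² n M′
        ≈⟨ +-cong (+-cong (*-zero (M zero zero) (diag zero)) (+-cong s≈ s≈))
             (trace²-hom n M′ w′ (diag ∘ suc) λ i j i≢j → off (suc i) (suc j) (i≢j ∘ Fin.suc-injective)) ⟩
      0# + (f r + f r) + f (offDiagonalSum n w′)
        ≈⟨ +-congʳ (trans (+-identityˡ (f r + f r)) (sym (f-+ r r))) ⟩
      f (r ℕ.+ r) + f (offDiagonalSum n w′)
        ≈⟨ f-+ (r ℕ.+ r) (offDiagonalSum n w′) ⟨
      f (r ℕ.+ r ℕ.+ offDiagonalSum n w′) ∎
      where
      M′ = remove M zero
      w′ = λ i j → w (suc i) (suc j)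
      s = sum λ j → M zero (suc j) * M (suc j) zero
      r = sumℕ λ j → w zero (suc j)
      s≈ : s ≈ f r
      s≈ = trans (sum-cong n λ j → off zero (suc j) λ ()) (sym (sum-hom λ j → w zero (suc j)))

open import Defs

-- The reals as an ordered ring

module ℚS = ℚ.+-*-Solver

p<p+ε : ∀ p {ε} → 0ℚ ℚ.< ε → p ℚ.< p ℚ.+ ε
p<p+ε p {ε} 0<ε = ≡.subst (ℚ._< p ℚ.+ ε) (ℚ.+-identityʳ p) (ℚ.+-monoʳ-< p 0<ε)

pointwise-≤ : ∀ x y → (∀ k → seq x k ℚ.≤ seq y k) → x ≤ y
pointwise-≤ x y x≤y ε 0<ε = 0 , λ k _ → ℚ.≤-<-trans (x≤y k) (p<p+ε (seq y k) 0<ε)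

pointwise-≃ : ∀ x y → (∀ k → seq x k ≡ seq y k) → x ≃ y
pointwise-≃ x y x≡y ε 0<ε = 0 , λ k _ → ≡.subst (ℚ._< ε)
  (≡.cong ℚ.∣_∣ (≡.sym (≡.trans (≡.cong (ℚ._- seq y k) (x≡y k)) (ℚ.+-inverseʳ (seq y k))))) 0<ε

≃⇒≤ : ∀ x y → x ≃ y → x ≤ y
≃⇒≤ x y x≃y ε 0<ε = x≃y ε 0<ε .proj₁ , λ k k≥ → begin-strict
  seq x k                            ≡⟨ split (seq x k) (seq y k) ⟩
  seq y k ℚ.+ (seq x k ℚ.- seq y k)  ≤⟨ ℚ.+-monoʳ-≤ (seq y k) (p≤∣p∣ (seq x k ℚ.- seq y k)) ⟩
  seq y k ℚ.+ ℚ.∣ seq x k ℚ.- seq y k ∣ <⟨ ℚ.+-monoʳ-< (seq y k) (x≃y ε 0<ε .proj₂ k k≥) ⟩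
  seq y k ℚ.+ ε                      ∎
  where
  open ℚ.≤-Reasoning
  split : ∀ a b → a ≡ b ℚ.+ (a ℚ.- b)
  split = ℚS.solve 2 (λ a b → a ℚS.:= b ℚS.:+ (a ℚS.:- b)) ≡.refl
  p≤∣p∣ : ∀ p → p ℚ.≤ ℚ.∣ p ∣
  p≤∣p∣ p with ℚ.≤-total 0ℚ p
  ... | inj₁ 0≤p = ℚ.≤-reflexive (≡.sym (ℚ.0≤p⇒∣p∣≡p 0≤p))
  ... | inj₂ p≤0 = ℚ.≤-trans p≤0 (ℚ.0≤∣p∣ p)

≤-trans : ∀ x y z → x ≤ y → y ≤ z → x ≤ z
≤-trans x y z x≤y y≤z ε 0<ε =
  let M , p = x≤y (½ ℚ.* ε) (half-pos 0<ε)
      N , q = y≤z (½ ℚ.* ε) (half-pos 0<ε)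
  in M ℕ.⊔ N , λ k k≥ → begin-strict
  seq x k
    <⟨ p k (ℕ.m⊔n≤o⇒m≤o M N k≥) ⟩
  seq y k ℚ.+ ½ ℚ.* ε
    <⟨ ℚ.+-monoˡ-< (½ ℚ.* ε) (q k (ℕ.m⊔n≤o⇒n≤o M N k≥)) ⟩
  seq z k ℚ.+ ½ ℚ.* ε ℚ.+ ½ ℚ.* ε
    ≡⟨ ℚ.+-assoc (seq z k) (½ ℚ.* ε) (½ ℚ.* ε) ⟩
  seq z k ℚ.+ (½ ℚ.* ε ℚ.+ ½ ℚ.* ε)
    ≡⟨ ≡.cong (seq z k ℚ.+_) (halves ε) ⟩
  seq z k ℚ.+ ε ∎
  where open ℚ.≤-Reasoning

p<q+ε⇒p-q<ε : ∀ p q {ε} → p ℚ.< q ℚ.+ ε → p ℚ.- q ℚ.< ε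
p<q+ε⇒p-q<ε p q {ε} p<q+ε = ≡.subst (p ℚ.- q ℚ.<_) (cancel q ε) (ℚ.+-monoˡ-< (ℚ.- q) p<q+ε)
  where
  cancel : ∀ a b → a ℚ.+ b ℚ.- a ≡ b
  cancel = ℚS.solve 2 (λ a b → a ℚS.:+ b ℚS.:- a ℚS.:= b) ≡.refl

≤-antisym : ∀ x y → x ≤ y → y ≤ x → x ≃ y
≤-antisym x y x≤y y≤x ε 0<ε =
  let M , p = x≤y ε 0<ε
      N , q = y≤x ε 0<ε
  in M ℕ.⊔ N , λ k k≥ → abs-bound (seq x k) (seq y k)
    (p<q+ε⇒p-q<ε (seq x k) (seq y k) (p k (ℕ.m⊔n≤o⇒m≤o M N k≥)))
    (p<q+ε⇒p-q<ε (seq y k) (seq x k) (q k (ℕ.m⊔n≤o⇒n≤o M N k≥)))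

≃-refl : ∀ x → x ≃ x
≃-refl x = pointwise-≃ x x λ _ → ≡.refl

≃-sym : ∀ x y → x ≃ y → y ≃ x
≃-sym x y x≃y ε 0<ε = x≃y ε 0<ε .proj₁ , λ k k≥ →
  ≡.subst (ℚ._< ε) (∣p-q∣≡∣q-p∣ (seq x k) (seq y k)) (x≃y ε 0<ε .proj₂ k k≥)

-- Deduced from the order, so that the splitting of ε into halves is done only for `≤-trans`.
≃-trans : ∀ x y z → x ≃ y → y ≃ z → x ≃ z
≃-trans x y z x≃y y≃z = ≤-antisym x z
  (≤-trans x y z (≃⇒≤ x y x≃y) (≃⇒≤ y z y≃z))
  (≤-trans z y x (≃⇒≤ z y (≃-sym y z y≃z)) (≃⇒≤ y x (≃-sym x y x≃y)))

≃-isEquivalence : IsEquivalence _≃_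
≃-isEquivalence = record
  { refl  = λ {x} → ≃-refl x
  ; sym   = λ {x} {y} → ≃-sym x y
  ; trans = λ {x} {y} {z} → ≃-trans x y z
  }

≃-setoid : Setoid 0ℓ 0ℓ
≃-setoid = record { isEquivalence = ≃-isEquivalence }

≤-preorder : Preorder 0ℓ 0ℓ 0ℓ
≤-preorder = record
  { _≲_ = _≤_
  ; isPreorder = record
    { isEquivalence = ≃-isEquivalence
    ; reflexive = λ {x} {y} → ≃⇒≤ x y
    ; trans = λ {x} {y} {z} → ≤-trans x y z
    }
  }

+-mono-≤ : ∀ x x′ y y′ → x ≤ x′ → y ≤ y′ → x + y ≤ x′ + y′
+-mono-≤ x x′ y y′ x≤ y≤ ε 0<ε =
  let M , p = x≤ (½ ℚ.* ε) (half-pos 0<ε)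
      N , q = y≤ (½ ℚ.* ε) (half-pos 0<ε)
  in M ℕ.⊔ N , λ k k≥ → begin-strict
  seq x k ℚ.+ seq y k
    <⟨ ℚ.+-mono-< (p k (ℕ.m⊔n≤o⇒m≤o M N k≥)) (q k (ℕ.m⊔n≤o⇒n≤o M N k≥)) ⟩
  (seq x′ k ℚ.+ ½ ℚ.* ε) ℚ.+ (seq y′ k ℚ.+ ½ ℚ.* ε)
    ≡⟨ rearrange (seq x′ k) (½ ℚ.* ε) (seq y′ k) ⟩
  (seq x′ k ℚ.+ seq y′ k) ℚ.+ (½ ℚ.* ε ℚ.+ ½ ℚ.* ε)
    ≡⟨ ≡.cong (seq x′ k ℚ.+ seq y′ k ℚ.+_) (halves ε) ⟩
  seq x′ k ℚ.+ seq y′ k ℚ.+ ε ∎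
  where
  open ℚ.≤-Reasoning
  rearrange : ∀ a e b → (a ℚ.+ e) ℚ.+ (b ℚ.+ e) ≡ (a ℚ.+ b) ℚ.+ (e ℚ.+ e)
  rearrange = ℚS.solve 3 (λ a e b → (a ℚS.:+ e) ℚS.:+ (b ℚS.:+ e) ℚS.:= (a ℚS.:+ b) ℚS.:+ (e ℚS.:+ e)) ≡.refl

+-cong : ∀ x x′ y y′ → x ≃ x′ → y ≃ y′ → x + y ≃ x′ + y′
+-cong x x′ y y′ x≃ y≃ = ≤-antisym (x + y) (x′ + y′)
  (+-mono-≤ x x′ y y′ (≃⇒≤ x x′ x≃) (≃⇒≤ y y′ y≃))
  (+-mono-≤ x′ x y′ y (≃⇒≤ x′ x (≃-sym x x′ x≃)) (≃⇒≤ y′ y (≃-sym y y′ y≃)))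

-‿cong : ∀ x y → x ≃ y → - x ≃ - y
-‿cong x y x≃y ε 0<ε = x≃y ε 0<ε .proj₁ , λ k k≥ →
  ≡.subst (ℚ._< ε) (≡.trans (∣p-q∣≡∣q-p∣ (seq x k) (seq y k)) (≡.cong ℚ.∣_∣ (flip (seq x k) (seq y k))))
    (x≃y ε 0<ε .proj₂ k k≥)
  where
  flip : ∀ a b → b ℚ.- a ≡ ℚ.- a ℚ.- ℚ.- b
  flip = ℚS.solve 2 (λ a b → b ℚS.:- a ℚS.:= ℚS.:- a ℚS.:- ℚS.:- b) ≡.refl

-- Write x y - x′ y′ = x (y - y′) + y′ (x - x′). Eventual bounds A on x and B on y′ give the
-- tolerances α and β with Aα = Bβ = ε/2.
*-cong : ∀ x x′ y y′ → x ≃ x′ → y ≃ y′ → x * y ≃ x′ * y′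
*-cong x x′ y y′ x≃ y≃ ε 0<ε =
  let A , 0<A , K , a = tail-bound (cauchy x)
      B , 0<B , L , b = tail-bound (cauchy y′)
      α , 0<α , Aα = quotient 0<A (half-pos 0<ε)
      β , 0<β , Bβ = quotient 0<B (half-pos 0<ε)
      M , p = y≃ α 0<α
      N , q = x≃ β 0<β
  in (K ℕ.⊔ L) ℕ.⊔ (M ℕ.⊔ N) , λ k k≥ →
    let KL = ℕ.m⊔n≤o⇒m≤o (K ℕ.⊔ L) (M ℕ.⊔ N) k≥
        MN = ℕ.m⊔n≤o⇒n≤o (K ℕ.⊔ L) (M ℕ.⊔ N) k≥
    in begin-strict
  ℚ.∣ seq x k ℚ.* seq y k ℚ.- seq x′ k ℚ.* seq y′ k ∣
    ≡⟨ ≡.cong ℚ.∣_∣ (rearrange (seq x k) (seq y k) (seq x′ k) (seq y′ k)) ⟩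
  ℚ.∣ seq x k ℚ.* (seq y k ℚ.- seq y′ k) ℚ.+ seq y′ k ℚ.* (seq x k ℚ.- seq x′ k) ∣
    ≤⟨ ℚ.∣p+q∣≤∣p∣+∣q∣ (seq x k ℚ.* (seq y k ℚ.- seq y′ k)) (seq y′ k ℚ.* (seq x k ℚ.- seq x′ k)) ⟩
  ℚ.∣ seq x k ℚ.* (seq y k ℚ.- seq y′ k) ∣ ℚ.+ ℚ.∣ seq y′ k ℚ.* (seq x k ℚ.- seq x′ k) ∣
    <⟨ ℚ.+-mono-<
         (small-product 0<A Aα (seq x k) (seq y k ℚ.- seq y′ k)
           (a k (ℕ.m⊔n≤o⇒m≤o K L KL)) (p k (ℕ.m⊔n≤o⇒m≤o M N MN)))
         (small-product 0<B Bβ (seq y′ k) (seq x k ℚ.- seq x′ k)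
           (b k (ℕ.m⊔n≤o⇒n≤o K L KL)) (q k (ℕ.m⊔n≤o⇒n≤o M N MN))) ⟩
  ½ ℚ.* ε ℚ.+ ½ ℚ.* ε
    ≡⟨ halves ε ⟩
  ε ∎
  where
  open ℚ.≤-Reasoning
  rearrange : ∀ a b c d → a ℚ.* b ℚ.- c ℚ.* d ≡ a ℚ.* (b ℚ.- d) ℚ.+ d ℚ.* (a ℚ.- c)
  rearrange = ℚS.solve 4 (λ a b c d → a ℚS.:* b ℚS.:- c ℚS.:* d ℚS.:=
    a ℚS.:* (b ℚS.:- d) ℚS.:+ d ℚS.:* (a ℚS.:- c)) ≡.refl

ℝ-isCommutativeRing : IsCommutativeRing _≃_ _+_ _*_ -_ (fromℕ 0) (fromℕ 1)
ℝ-isCommutativeRing = record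
  { isRing = record
    { +-isAbelianGroup = record
      { isGroup = record
        { isMonoid = record
          { isSemigroup = record
            { isMagma = record
              { isEquivalence = ≃-isEquivalence
              ; ∙-cong = λ {x} {x′} {y} {y′} → +-cong x x′ y y′
              }
            ; assoc = λ x y z → pointwise-≃ (x + y + z) (x + (y + z)) λ k → ℚ.+-assoc (seq x k) (seq y k) (seq z k)
            }
          ; identity = (λ x → pointwise-≃ (fromℕ 0 + x) x λ k → ℚ.+-identityˡ (seq x k))
                     , (λ x → pointwise-≃ (x + fromℕ 0) x λ k → ℚ.+-identityʳ (seq x k))
          }
        ; inverse = (λ x → pointwise-≃ (- x + x) (fromℕ 0) λ k → ℚ.+-inverseˡ (seq x k))
                  , (λ x → pointwise-≃ (x + - x) (fromℕ 0) λ k → ℚ.+-inverseʳ (seq x k))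
        ; ⁻¹-cong = λ {x} {y} → -‿cong x y
        }
      ; comm = λ x y → pointwise-≃ (x + y) (y + x) λ k → ℚ.+-comm (seq x k) (seq y k)
      }
    ; *-cong = λ {x} {x′} {y} {y′} → *-cong x x′ y y′
    ; *-assoc = λ x y z → pointwise-≃ (x * y * z) (x * (y * z)) λ k → ℚ.*-assoc (seq x k) (seq y k) (seq z k)
    ; *-identity = (λ x → pointwise-≃ (fromℕ 1 * x) x λ k → ℚ.*-identityˡ (seq x k))
                 , (λ x → pointwise-≃ (x * fromℕ 1) x λ k → ℚ.*-identityʳ (seq x k))
    ; distrib = (λ x y z → pointwise-≃ (x * (y + z)) (x * y + x * z) λ k → ℚ.*-distribˡ-+ (seq x k) (seq y k) (seq z k))
              , (λ x y z → pointwise-≃ ((y + z) * x) (y * x + z * x) λ k → ℚ.*-distribʳ-+ (seq x k) (seq y k) (seq z k))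
    }
  ; *-comm = λ x y → pointwise-≃ (x * y) (y * x) λ k → ℚ.*-comm (seq x k) (seq y k)
  }

-- Inequalities between squares

square-mono-≤ : ∀ {p q} → 0ℚ ℚ.≤ q → q ℚ.≤ p → q ℚ.* q ℚ.≤ p ℚ.* p
square-mono-≤ {p} {q} 0≤q q≤p = ℚ.≤-trans
  (ℚ.*-monoˡ-≤-nonNeg q {{ℚ.nonNegative 0≤q}} q≤p)
  (ℚ.*-monoʳ-≤-nonNeg p {{ℚ.nonNegative (ℚ.≤-trans 0≤q q≤p)}} q≤p)

0≤p*q : ∀ {p q} → 0ℚ ℚ.≤ p → 0ℚ ℚ.≤ q → 0ℚ ℚ.≤ p ℚ.* q
0≤p*q {p} {q} 0≤p 0≤q = ≡.subst (ℚ._≤ p ℚ.* q) (ℚ.*-zeroʳ p)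
  (ℚ.*-monoˡ-≤-nonNeg p {{ℚ.nonNegative 0≤p}} 0≤q)

0≤p² : ∀ p → 0ℚ ℚ.≤ p ℚ.* p
0≤p² p with ℚ.≤-total 0ℚ p
... | inj₁ 0≤p = 0≤p*q 0≤p 0≤p
... | inj₂ p≤0 = ≡.subst (0ℚ ℚ.≤_) (square p) (0≤p*q 0≤-p 0≤-p)
  where
  0≤-p = ℚ.neg-antimono-≤ p≤0
  square : ∀ a → ℚ.- a ℚ.* ℚ.- a ≡ a ℚ.* a
  square = ℚS.solve 1 (λ a → ℚS.:- a ℚS.:* ℚS.:- a ℚS.:= a ℚS.:* a) ≡.refl

0≤+ : ∀ {p q} → 0ℚ ℚ.≤ p → 0ℚ ℚ.≤ q → 0ℚ ℚ.≤ p ℚ.+ q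
0≤+ 0≤p 0≤q = ℚ.+-mono-≤ 0≤p 0≤q

p≤p+q : ∀ p {q} → 0ℚ ℚ.≤ q → p ℚ.≤ p ℚ.+ q
p≤p+q p {q} 0≤q = ≡.subst (ℚ._≤ p ℚ.+ q) (ℚ.+-identityʳ p) (ℚ.+-monoʳ-≤ p 0≤q)

-- Apply the hypothesis with tolerance ε². If x were at least y + ε at a late index, then x² ≥ (y +
-- ε)² ≥ y² + ε² there, because y is non-negative at that very index.
square-cancel-≤ : ∀ x y → (∀ k → 0ℚ ℚ.≤ seq y k) → x * x ≤ y * y → x ≤ y
square-cancel-≤ x y 0≤y x²≤y² ε 0<ε = N , λ k k≥ → ℚ.≰⇒> λ y+ε≤x → ℚ.<-irrefl ≡.refl (ℚ.<-≤-trans (x²< k k≥) (begin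
  seq y k ℚ.* seq y k ℚ.+ ε ℚ.* ε
    ≤⟨ p≤p+q _ (0≤p*q (0≤+ (0≤y k) (0≤y k)) 0≤ε) ⟩
  seq y k ℚ.* seq y k ℚ.+ ε ℚ.* ε ℚ.+ (seq y k ℚ.+ seq y k) ℚ.* ε
    ≡⟨ binomial (seq y k) ε ⟩
  (seq y k ℚ.+ ε) ℚ.* (seq y k ℚ.+ ε)
    ≤⟨ square-mono-≤ (0≤+ (0≤y k) 0≤ε) y+ε≤x ⟩
  seq x k ℚ.* seq x k ∎))
  where
  open ℚ.≤-Reasoning
  0≤ε = ℚ.<⇒≤ 0<ε
  0<ε² : 0ℚ ℚ.< ε ℚ.* ε
  0<ε² = ≡.subst (ℚ._< ε ℚ.* ε) (ℚ.*-zeroʳ ε) (ℚ.*-monoʳ-<-pos ε {{ℚ.positive 0<ε}} 0<ε)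
  N = x²≤y² (ε ℚ.* ε) 0<ε² .proj₁
  x²< = x²≤y² (ε ℚ.* ε) 0<ε² .proj₂
  binomial : ∀ a e → a ℚ.* a ℚ.+ e ℚ.* e ℚ.+ (a ℚ.+ a) ℚ.* e ≡ (a ℚ.+ e) ℚ.* (a ℚ.+ e)
  binomial = ℚS.solve 2 (λ a e → a ℚS.:* a ℚS.:+ e ℚS.:* e ℚS.:+ (a ℚS.:+ a) ℚS.:* e ℚS.:=
    (a ℚS.:+ e) ℚS.:* (a ℚS.:+ e)) ≡.refl

*-nonNeg : ∀ x y → (∀ k → 0ℚ ℚ.≤ seq x k) → (∀ k → 0ℚ ℚ.≤ seq y k) → ∀ k → 0ℚ ℚ.≤ seq (x * y) k
*-nonNeg x y 0≤x 0≤y k = 0≤p*q (0≤x k) (0≤y k)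

x[xy²]≃[xy]² : ∀ x y → x * (x * (y * y)) ≃ (x * y) * (x * y)
x[xy²]≃[xy]² x y = pointwise-≃ (x * (x * (y * y))) ((x * y) * (x * y)) λ k → rearrange (seq x k) (seq y k)
  where
  rearrange : ∀ a b → a ℚ.* (a ℚ.* (b ℚ.* b)) ≡ (a ℚ.* b) ℚ.* (a ℚ.* b)
  rearrange = ℚS.solve 2 (λ a b → a ℚS.:* (a ℚS.:* (b ℚS.:* b)) ℚS.:= (a ℚS.:* b) ℚS.:* (a ℚS.:* b)) ≡.refl

-- Integers and square roots as reals

fromℤ-+ : ∀ a b → fromℤ (a ℤ.+ b) ≃ fromℤ a + fromℤ b
fromℤ-+ a b = pointwise-≃ (fromℤ (a ℤ.+ b)) (fromℤ a + fromℤ b) λ _ → ℚ.toℚᵘ-injective (begin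
  ℚ.toℚᵘ ((a ℤ.+ b) ℚ./ 1)
    ≈⟨ ℚ.toℚᵘ-fromℚᵘ (mkℚᵘ (a ℤ.+ b) 0) ⟩
  mkℚᵘ (a ℤ.+ b) 0
    ≈⟨ *≡* (≡.cong (ℤ._* + 1) (≡.sym (≡.cong₂ ℤ._+_ (ℤ.*-identityʳ a) (ℤ.*-identityʳ b)))) ⟩
  mkℚᵘ a 0 ℚᵘ.+ mkℚᵘ b 0
    ≈⟨ ℚᵘ.+-cong (ℚ.toℚᵘ-fromℚᵘ (mkℚᵘ a 0)) (ℚ.toℚᵘ-fromℚᵘ (mkℚᵘ b 0)) ⟨
  ℚ.toℚᵘ (a ℚ./ 1) ℚᵘ.+ ℚ.toℚᵘ (b ℚ./ 1)
    ≈⟨ ℚ.toℚᵘ-homo-+ (a ℚ./ 1) (b ℚ./ 1) ⟨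
  ℚ.toℚᵘ (a ℚ./ 1 ℚ.+ b ℚ./ 1) ∎)
  where open ℚᵘ.≃-Reasoning

/-* : ∀ a k b l → (a ℚ./ suc k) ℚ.* (b ℚ./ suc l) ≡ (a ℤ.* b) ℚ./ (suc k ℕ.* suc l)
/-* a k b l = ℚ.toℚᵘ-injective (begin
  ℚ.toℚᵘ ((a ℚ./ suc k) ℚ.* (b ℚ./ suc l))
    ≈⟨ ℚ.toℚᵘ-homo-* (a ℚ./ suc k) (b ℚ./ suc l) ⟩
  ℚ.toℚᵘ (a ℚ./ suc k) ℚᵘ.* ℚ.toℚᵘ (b ℚ./ suc l)
    ≈⟨ ℚᵘ.*-cong (ℚ.toℚᵘ-fromℚᵘ (mkℚᵘ a k)) (ℚ.toℚᵘ-fromℚᵘ (mkℚᵘ b l)) ⟩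
  mkℚᵘ a k ℚᵘ.* mkℚᵘ b l
    ≈⟨ ℚ.toℚᵘ-fromℚᵘ (mkℚᵘ a k ℚᵘ.* mkℚᵘ b l) ⟨
  ℚ.toℚᵘ ((a ℤ.* b) ℚ./ (suc k ℕ.* suc l)) ∎)
  where open ℚᵘ.≃-Reasoning

fromℤ-* : ∀ a b → fromℤ (a ℤ.* b) ≃ fromℤ a * fromℤ b
fromℤ-* a b = pointwise-≃ (fromℤ (a ℤ.* b)) (fromℤ a * fromℤ b) λ _ → ≡.sym (/-* a 0 b 0)

fromℕ-* : ∀ a b → fromℕ (a ℕ.* b) ≃ fromℕ a * fromℕ b
fromℕ-* a b = ≡.subst (λ c → fromℤ c ≃ fromℕ a * fromℕ b) (≡.sym (ℤ.pos-* a b)) (fromℤ-* (+ a) (+ b))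

/-mono-≤ : ∀ a k b l → a ℕ.* suc l ℕ.≤ b ℕ.* suc k → (+ a) ℚ./ suc k ℚ.≤ (+ b) ℚ./ suc l
/-mono-≤ a k b l h = ℚ.toℚᵘ-cancel-≤ (begin
  ℚ.toℚᵘ ((+ a) ℚ./ suc k)  ≃⟨ ℚ.toℚᵘ-fromℚᵘ (mkℚᵘ (+ a) k) ⟩
  mkℚᵘ (+ a) k              ≤⟨ *≤* (≡.subst₂ ℤ._≤_ (ℤ.pos-* a (suc l)) (ℤ.pos-* b (suc k)) (ℤ.+≤+ h)) ⟩
  mkℚᵘ (+ b) l              ≃⟨ ℚ.toℚᵘ-fromℚᵘ (mkℚᵘ (+ b) l) ⟨
  ℚ.toℚᵘ ((+ b) ℚ./ suc l)  ∎)
  where open ℚᵘ.≤-Reasoning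

fromℕ-mono-≤ : ∀ {a b} → a ℕ.≤ b → fromℕ a ≤ fromℕ b
fromℕ-mono-≤ {a} {b} a≤b = pointwise-≤ (fromℕ a) (fromℕ b) λ _ → /-mono-≤ a 0 b 0 (ℕ.*-monoˡ-≤ 1 a≤b)

-- Integers are one apart, so the single tolerance ε = 1 decides.
fromℕ-cancel-≤ : ∀ {a b} → fromℕ a ≤ fromℕ b → a ℕ.≤ b
fromℕ-cancel-≤ {a} {b} a≤b = ℕ.≮⇒≥ λ b<a → ℚ.<-irrefl ≡.refl (ℚ.<-≤-trans a<1+b (/-mono-≤ (suc b) 0 a 0 (ℕ.*-monoˡ-≤ 1 b<a)))
  where
  a<1+b : (+ a) ℚ./ 1 ℚ.< (+ suc b) ℚ./ 1
  a<1+b = ≡.subst ((+ a) ℚ./ 1 ℚ.<_) (≡.sym (suc-/ b 0))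
    (let N , h = a≤b 1ℚ (ℚ.positive⁻¹ 1ℚ) in h N ℕ.≤-refl)

0≤/ : ∀ a k → 0ℚ ℚ.≤ (+ a) ℚ./ suc k
0≤/ a k = /-mono-≤ 0 0 a k ℕ.z≤n

√-nonNeg : ∀ m k → 0ℚ ℚ.≤ seq (√ m) k
√-nonNeg m k = 0≤/ (isqrt (m ℕ.* (suc k ℕ.* suc k))) k

1/-cauchy : IsCauchy (λ k → (+ 1) ℚ./ suc k)
1/-cauchy ε 0<ε = N , λ i j i≥ j≥ → abs-bound ((+ 1) ℚ./ suc i) ((+ 1) ℚ./ suc j) (close i j i≥) (close j i j≥)
  where
  N = archimedean ε 0<ε .proj₁
  close : ∀ i j → N ℕ.≤ i → (+ 1) ℚ./ suc i ℚ.- (+ 1) ℚ./ suc j ℚ.< ε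
  close i j i≥ = ℚ.≤-<-trans
    (≡.subst ((+ 1) ℚ./ suc i ℚ.- (+ 1) ℚ./ suc j ℚ.≤_) (ℚ.+-identityʳ ((+ 1) ℚ./ suc i))
      (ℚ.+-monoʳ-≤ ((+ 1) ℚ./ suc i) (ℚ.neg-antimono-≤ (0≤/ 1 j))))
    (archimedean ε 0<ε .proj₂ i i≥)

-- The grid width at index k: adding it to ⌊(k + 1)√m⌋/(k + 1) gives a rational above √m.
infinitesimal : ℝ
infinitesimal = mkℝ (λ k → (+ 1) ℚ./ suc k) 1/-cauchy

infinitesimal≃0 : infinitesimal ≃ fromℕ 0
infinitesimal≃0 ε 0<ε = archimedean ε 0<ε .proj₁ , λ k k≥ → ≡.subst (ℚ._< ε)
  (≡.sym (≡.trans (≡.cong ℚ.∣_∣ (ℚ.+-identityʳ ((+ 1) ℚ./ suc k))) (ℚ.0≤p⇒∣p∣≡p (0≤/ 1 k))))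
  (archimedean ε 0<ε .proj₂ k k≥)

-- Two brackets hold at every index: the square of the approximation is at most m, and the square of
-- the next grid point is at least m. The grid points differ by a null sequence, so both squares are
-- the same real.
√-square : ∀ m → √ m * √ m ≃ fromℕ m
√-square m = ≤-antisym (√ m * √ m) (fromℕ m)
  (pointwise-≤ (√ m * √ m) (fromℕ m) lower)
  (≤-trans (fromℕ m) (upper * upper) (√ m * √ m)
    (pointwise-≤ (fromℕ m) (upper * upper) below)
    (≃⇒≤ (upper * upper) (√ m * √ m) (*-cong upper (√ m) upper (√ m) upper≃√ upper≃√)))
  where
  open IsCommutativeRing ℝ-isCommutativeRing using (+-identityʳ)
  open ℚ.≤-Reasoning
  upper = √ m + infinitesimal
  upper≃√ : upper ≃ √ m
  upper≃√ = ≃-trans upper (√ m + fromℕ 0) (√ m)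
    (+-cong (√ m) (√ m) infinitesimal (fromℕ 0) (≃-refl (√ m)) infinitesimal≃0) (+-identityʳ (√ m))
  root : ℕ → ℕ
  root k = isqrt (m ℕ.* (suc k ℕ.* suc k))
  square-/ : ∀ a k → ((+ a) ℚ./ suc k) ℚ.* ((+ a) ℚ./ suc k) ≡ (+ (a ℕ.* a)) ℚ./ (suc k ℕ.* suc k)
  square-/ a k = ≡.trans (/-* (+ a) k (+ a) k) (≡.cong (λ b → b ℚ./ (suc k ℕ.* suc k)) (≡.sym (ℤ.pos-* a a)))
  lower : ∀ k → √-seq m k ℚ.* √-seq m k ℚ.≤ (+ m) ℚ./ 1
  lower k = ≡.subst (ℚ._≤ (+ m) ℚ./ 1) (≡.sym (square-/ (root k) k))
    -- `/-mono-≤` takes predecessors of denominators, and (k + 1)² unfolds to the successor of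
    -- `k ℕ.+ k ℕ.* suc k`.
    (/-mono-≤ (root k ℕ.* root k) (k ℕ.+ k ℕ.* suc k) m 0
      (ℕ.≤-trans (ℕ.≤-reflexive (ℕ.*-identityʳ (root k ℕ.* root k))) (isqrt-lower (m ℕ.* (suc k ℕ.* suc k)))))
  below : ∀ k → (+ m) ℚ./ 1 ℚ.≤ seq (upper * upper) k
  below k = ≡.subst ((+ m) ℚ./ 1 ℚ.≤_)
    (≡.trans (≡.sym (square-/ (suc (root k)) k)) (≡.cong (λ q → q ℚ.* q) (suc-/ (root k) k)))
    (/-mono-≤ m 0 (suc (root k) ℕ.* suc (root k)) (k ℕ.+ k ℕ.* suc k)
      (ℕ.≤-trans (ℕ.<⇒≤ (isqrt-upper (m ℕ.* (suc k ℕ.* suc k))))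
        (ℕ.≤-reflexive (≡.sym (ℕ.*-identityʳ (suc (root k) ℕ.* suc (root k)))))))

-- The inequalities ∑ xᵢ² ≤ (∑ |xᵢ|)² ≤ n ∑ xᵢ²

∑-abs-nonNeg : ∀ {n} (x : Vector ℝ n) k → 0ℚ ℚ.≤ seq (∑ λ i → abs (x i)) k
∑-abs-nonNeg {zero}  x k = ℚ.≤-refl
∑-abs-nonNeg {suc n} x k = 0≤+ (ℚ.0≤∣p∣ (seq (x zero) k)) (∑-abs-nonNeg (x ∘ suc) k)

∣p∣*∣p∣≡p*p : ∀ p → ℚ.∣ p ∣ ℚ.* ℚ.∣ p ∣ ≡ p ℚ.* p
∣p∣*∣p∣≡p*p p = ≡.trans (≡.sym (ℚ.∣p*q∣≡∣p∣*∣q∣ p p)) (ℚ.0≤p⇒∣p∣≡p (0≤p² p))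

-- Induction step in which s and q are the sums over the tail: the cross terms 2∣p∣s are
-- non-negative.
p²+q≤[∣p∣+s]² : ∀ p {q s} → 0ℚ ℚ.≤ s → q ℚ.≤ s ℚ.* s →
  p ℚ.* p ℚ.+ q ℚ.≤ (ℚ.∣ p ∣ ℚ.+ s) ℚ.* (ℚ.∣ p ∣ ℚ.+ s)
p²+q≤[∣p∣+s]² p {q} {s} 0≤s q≤s² = begin
  p ℚ.* p ℚ.+ q
    ≤⟨ ℚ.+-monoʳ-≤ (p ℚ.* p) q≤s² ⟩
  p ℚ.* p ℚ.+ s ℚ.* s
    ≡⟨ ≡.cong (ℚ._+ s ℚ.* s) (∣p∣*∣p∣≡p*p p) ⟨
  a ℚ.* a ℚ.+ s ℚ.* s
    ≤⟨ p≤p+q (a ℚ.* a ℚ.+ s ℚ.* s) (0≤+ 0≤as 0≤as) ⟩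
  a ℚ.* a ℚ.+ s ℚ.* s ℚ.+ (a ℚ.* s ℚ.+ a ℚ.* s)
    ≡⟨ binomial a s ⟩
  (a ℚ.+ s) ℚ.* (a ℚ.+ s) ∎
  where
  open ℚ.≤-Reasoning
  a = ℚ.∣ p ∣
  0≤as = 0≤p*q (ℚ.0≤∣p∣ p) 0≤s
  binomial : ∀ a s → a ℚ.* a ℚ.+ s ℚ.* s ℚ.+ (a ℚ.* s ℚ.+ a ℚ.* s) ≡ (a ℚ.+ s) ℚ.* (a ℚ.+ s)
  binomial = ℚS.solve 2 (λ a s → a ℚS.:* a ℚS.:+ s ℚS.:* s ℚS.:+ (a ℚS.:* s ℚS.:+ a ℚS.:* s) ℚS.:=
    (a ℚS.:+ s) ℚS.:* (a ℚS.:+ s)) ≡.refl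

∑²≤[∑∣∣]² : ∀ {n} (x : Vector ℝ n) →
  (∑ λ i → x i * x i) ≤ (∑ λ i → abs (x i)) * (∑ λ i → abs (x i))
∑²≤[∑∣∣]² {n} x = pointwise-≤ (∑ λ i → x i * x i) ((∑ λ i → abs (x i)) * (∑ λ i → abs (x i))) (go x)
  where
  go : ∀ {n} (x : Vector ℝ n) k → seq (∑ λ i → x i * x i) k ℚ.≤
    seq (∑ λ i → abs (x i)) k ℚ.* seq (∑ λ i → abs (x i)) k
  go {zero}  x k = ℚ.≤-refl
  go {suc n} x k = p²+q≤[∣p∣+s]² (seq (x zero) k) (∑-abs-nonNeg (x ∘ suc) k) (go (x ∘ suc) k)

-- Induction step for 2a ∑∣xᵢ∣ ≤ n a² + ∑ xᵢ². Each new summand is an instance of 2ab ≤ a² + b²,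
-- that is, of (a - b)² ≥ 0.
cross-step : ∀ a p s m q → a ℚ.* s ℚ.+ a ℚ.* s ℚ.≤ m ℚ.* (a ℚ.* a) ℚ.+ q →
  a ℚ.* (ℚ.∣ p ∣ ℚ.+ s) ℚ.+ a ℚ.* (ℚ.∣ p ∣ ℚ.+ s) ℚ.≤ (m ℚ.+ 1ℚ) ℚ.* (a ℚ.* a) ℚ.+ (p ℚ.* p ℚ.+ q)
cross-step a p s m q h = begin
  a ℚ.* (b ℚ.+ s) ℚ.+ a ℚ.* (b ℚ.+ s)
    ≡⟨ expand a b s ⟩
  (a ℚ.* b ℚ.+ a ℚ.* b) ℚ.+ (a ℚ.* s ℚ.+ a ℚ.* s)
    ≤⟨ ℚ.+-mono-≤ (p≤p+q (a ℚ.* b ℚ.+ a ℚ.* b) (0≤p² (a ℚ.- b))) h ⟩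
  (a ℚ.* b ℚ.+ a ℚ.* b ℚ.+ (a ℚ.- b) ℚ.* (a ℚ.- b)) ℚ.+ (m ℚ.* (a ℚ.* a) ℚ.+ q)
    ≡⟨ collect a b m q ⟩
  (m ℚ.+ 1ℚ) ℚ.* (a ℚ.* a) ℚ.+ (b ℚ.* b ℚ.+ q)
    ≡⟨ ≡.cong (λ c → (m ℚ.+ 1ℚ) ℚ.* (a ℚ.* a) ℚ.+ (c ℚ.+ q)) (∣p∣*∣p∣≡p*p p) ⟩
  (m ℚ.+ 1ℚ) ℚ.* (a ℚ.* a) ℚ.+ (p ℚ.* p ℚ.+ q) ∎
  where
  open ℚ.≤-Reasoning
  b = ℚ.∣ p ∣
  expand : ∀ a b s → a ℚ.* (b ℚ.+ s) ℚ.+ a ℚ.* (b ℚ.+ s) ≡ (a ℚ.* b ℚ.+ a ℚ.* b) ℚ.+ (a ℚ.* s ℚ.+ a ℚ.* s)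
  expand = ℚS.solve 3 (λ a b s → a ℚS.:* (b ℚS.:+ s) ℚS.:+ a ℚS.:* (b ℚS.:+ s) ℚS.:=
    (a ℚS.:* b ℚS.:+ a ℚS.:* b) ℚS.:+ (a ℚS.:* s ℚS.:+ a ℚS.:* s)) ≡.refl
  collect : ∀ a b n q → (a ℚ.* b ℚ.+ a ℚ.* b ℚ.+ (a ℚ.- b) ℚ.* (a ℚ.- b)) ℚ.+ (n ℚ.* (a ℚ.* a) ℚ.+ q)
    ≡ (n ℚ.+ 1ℚ) ℚ.* (a ℚ.* a) ℚ.+ (b ℚ.* b ℚ.+ q)
  collect = ℚS.solve 4 (λ a b n q →
    (a ℚS.:* b ℚS.:+ a ℚS.:* b ℚS.:+ (a ℚS.:- b) ℚS.:* (a ℚS.:- b)) ℚS.:+ (n ℚS.:* (a ℚS.:* a) ℚS.:+ q)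
    ℚS.:= (n ℚS.:+ ℚS.con 1ℚ) ℚS.:* (a ℚS.:* a) ℚS.:+ (b ℚS.:* b ℚS.:+ q)) ≡.refl

-- Induction step for Cauchy-Schwarz against the all-ones vector: in p² + 2∣p∣s + s², the middle
-- term is bounded by m p² + q and the last by m q, which adds up to (m + 1)(p² + q).
square-step : ∀ p s m q → ℚ.∣ p ∣ ℚ.* s ℚ.+ ℚ.∣ p ∣ ℚ.* s ℚ.≤ m ℚ.* (ℚ.∣ p ∣ ℚ.* ℚ.∣ p ∣) ℚ.+ q →
  s ℚ.* s ℚ.≤ m ℚ.* q →
  (ℚ.∣ p ∣ ℚ.+ s) ℚ.* (ℚ.∣ p ∣ ℚ.+ s) ℚ.≤ (m ℚ.+ 1ℚ) ℚ.* (p ℚ.* p ℚ.+ q)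
square-step p s m q cross h = begin
  (a ℚ.+ s) ℚ.* (a ℚ.+ s)
    ≡⟨ expand a s ⟩
  a ℚ.* a ℚ.+ ((a ℚ.* s ℚ.+ a ℚ.* s) ℚ.+ s ℚ.* s)
    ≤⟨ ℚ.+-monoʳ-≤ (a ℚ.* a) (ℚ.+-mono-≤ cross h) ⟩
  a ℚ.* a ℚ.+ ((m ℚ.* (a ℚ.* a) ℚ.+ q) ℚ.+ m ℚ.* q)
    ≡⟨ factor (a ℚ.* a) m q ⟩
  (m ℚ.+ 1ℚ) ℚ.* (a ℚ.* a ℚ.+ q)
    ≡⟨ ≡.cong (λ c → (m ℚ.+ 1ℚ) ℚ.* (c ℚ.+ q)) (∣p∣*∣p∣≡p*p p) ⟩
  (m ℚ.+ 1ℚ) ℚ.* (p ℚ.* p ℚ.+ q) ∎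
  where
  open ℚ.≤-Reasoning
  a = ℚ.∣ p ∣
  expand : ∀ a s → (a ℚ.+ s) ℚ.* (a ℚ.+ s) ≡ a ℚ.* a ℚ.+ ((a ℚ.* s ℚ.+ a ℚ.* s) ℚ.+ s ℚ.* s)
  expand = ℚS.solve 2 (λ a s → (a ℚS.:+ s) ℚS.:* (a ℚS.:+ s) ℚS.:=
    a ℚS.:* a ℚS.:+ ((a ℚS.:* s ℚS.:+ a ℚS.:* s) ℚS.:+ s ℚS.:* s)) ≡.refl
  factor : ∀ a n q → a ℚ.+ ((n ℚ.* a ℚ.+ q) ℚ.+ n ℚ.* q) ≡ (n ℚ.+ 1ℚ) ℚ.* (a ℚ.+ q)
  factor = ℚS.solve 3 (λ a n q → a ℚS.:+ ((n ℚS.:* a ℚS.:+ q) ℚS.:+ n ℚS.:* q) ℚS.:=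
    (n ℚS.:+ ℚS.con 1ℚ) ℚS.:* (a ℚS.:+ q)) ≡.refl

[∑∣∣]²≤n∑² : ∀ {n} (x : Vector ℝ n) →
  (∑ λ i → abs (x i)) * (∑ λ i → abs (x i)) ≤ fromℕ n * (∑ λ i → x i * x i)
[∑∣∣]²≤n∑² {n} x = pointwise-≤ ((∑ λ i → abs (x i)) * (∑ λ i → abs (x i))) (fromℕ n * (∑ λ i → x i * x i)) (square x)
  where
  s q : ∀ {n} → Vector ℝ n → ℕ → ℚ
  s x k = seq (∑ λ i → abs (x i)) k
  q x k = seq (∑ λ i → x i * x i) k
  zeros : ∀ a → a ℚ.* 0ℚ ℚ.+ a ℚ.* 0ℚ ≡ 0ℚ ℚ.* (a ℚ.* a) ℚ.+ 0ℚ
  zeros = ℚS.solve 1 (λ a → a ℚS.:* ℚS.con 0ℚ ℚS.:+ a ℚS.:* ℚS.con 0ℚ ℚS.:=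
    ℚS.con 0ℚ ℚS.:* (a ℚS.:* a) ℚS.:+ ℚS.con 0ℚ) ≡.refl
  cross : ∀ a {n} (x : Vector ℝ n) k → a ℚ.* s x k ℚ.+ a ℚ.* s x k ℚ.≤ (+ n) ℚ./ 1 ℚ.* (a ℚ.* a) ℚ.+ q x k
  cross a {zero}  x k = ℚ.≤-reflexive (zeros a)
  cross a {suc n} x k = ≡.subst (λ m → a ℚ.* s x k ℚ.+ a ℚ.* s x k ℚ.≤ m ℚ.* (a ℚ.* a) ℚ.+ q x k) (≡.sym (suc-/ n 0))
    (cross-step a (seq (x zero) k) (s (x ∘ suc) k) ((+ n) ℚ./ 1) (q (x ∘ suc) k) (cross a (x ∘ suc) k))
  square : ∀ {n} (x : Vector ℝ n) k → s x k ℚ.* s x k ℚ.≤ (+ n) ℚ./ 1 ℚ.* q x k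
  square {zero}  x k = ℚ.≤-refl
  square {suc n} x k = ≡.subst (λ m → s x k ℚ.* s x k ℚ.≤ m ℚ.* q x k) (≡.sym (suc-/ n 0))
    (square-step (seq (x zero) k) (s (x ∘ suc) k) ((+ n) ℚ./ 1) (q (x ∘ suc) k)
      (cross ℚ.∣ seq (x zero) k ∣ (x ∘ suc) k) (square (x ∘ suc) k))

-- Off-diagonal sums of (1 − 2c)²


n≤sum : ∀ {n} (f : Vector ℕ n) → (∀ i → 1 ℕ.≤ f i) → n ℕ.≤ sumℕ f
n≤sum {zero}  f 1≤f = z≤n
n≤sum {suc n} f 1≤f = ℕ.+-mono-≤ (1≤f zero) (n≤sum (f ∘ suc) (1≤f ∘ suc))

sum≡n : ∀ {n} (f : Vector ℕ n) → (∀ i → f i ≡ 1) → sumℕ f ≡ n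
sum≡n {zero}  f f≡1 = ≡.refl
sum≡n {suc n} f f≡1 = ≡.cong₂ ℕ._+_ (f≡1 zero) (sum≡n (f ∘ suc) (f≡1 ∘ suc))

-- Two lower bounds whose sum is attained are each attained. This is how equality in a sum descends
-- to its summands.
+-cancel-bounds : ∀ {a b c d} → a ℕ.≤ c → b ℕ.≤ d → c ℕ.+ d ℕ.≤ a ℕ.+ b → c ℕ.≤ a × d ℕ.≤ b
+-cancel-bounds {a} {b} {c} {d} a≤c b≤d c+d≤a+b =
    ℕ.+-cancelʳ-≤ d c a (ℕ.≤-trans c+d≤a+b (ℕ.+-monoʳ-≤ a b≤d))
  , ℕ.+-cancelˡ-≤ c d b (ℕ.≤-trans c+d≤a+b (ℕ.+-monoˡ-≤ b a≤c))

sum≤n⇒≤1 : ∀ {n} (f : Vector ℕ n) → (∀ i → 1 ℕ.≤ f i) → sumℕ f ℕ.≤ n → ∀ i → f i ℕ.≤ 1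
sum≤n⇒≤1 {suc n} f 1≤f sum≤ = λ
  { zero    → proj₁ bounds
  ; (suc i) → sum≤n⇒≤1 (f ∘ suc) (1≤f ∘ suc) (proj₂ bounds) i
  }
  where bounds = +-cancel-bounds (1≤f zero) (n≤sum (f ∘ suc) (1≤f ∘ suc)) sum≤

-- The square (1 - 2c)² = 1 + 4c(c - 1) as a natural number, in a form that shows it is at least 1.
-- At c = 0 the truncated subtraction is harmless, since the factor c vanishes.
weight : ℕ → ℕ
weight c = 1 ℕ.+ 4 ℕ.* (c ℕ.* (c ∸ 1))

1≤weight : ∀ c → 1 ℕ.≤ weight c
1≤weight c = s≤s z≤n

c≤1⇒weight≡1 : ∀ {c} → c ℕ.≤ 1 → weight c ≡ 1
c≤1⇒weight≡1 z≤n       = ≡.refl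
c≤1⇒weight≡1 (s≤s z≤n) = ≡.refl

weight≤1⇒c≤1 : ∀ c → weight c ℕ.≤ 1 → c ℕ.≤ 1
weight≤1⇒c≤1 0             _        = z≤n
weight≤1⇒c≤1 1             _        = s≤s z≤n
weight≤1⇒c≤1 (suc (suc c)) (s≤s ())

weight-square : ∀ c → (1ℤ ℤ.- + 2 ℤ.* + c) ℤ.* (1ℤ ℤ.- + 2 ℤ.* + c) ≡ + weight c
weight-square zero    = ≡.refl
weight-square (suc c) = ≡.trans (expand (+ c))
  (≡.cong (λ z → 1ℤ ℤ.+ z) (≡.trans (≡.cong (λ z → + 4 ℤ.* z) (≡.sym (ℤ.pos-* (suc c) c))) (≡.sym (ℤ.pos-* 4 (suc c ℕ.* c)))))
  where
  open ℤ.+-*-Solver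
  expand : ∀ c → (1ℤ ℤ.- + 2 ℤ.* (1ℤ ℤ.+ c)) ℤ.* (1ℤ ℤ.- + 2 ℤ.* (1ℤ ℤ.+ c)) ≡ 1ℤ ℤ.+ + 4 ℤ.* ((1ℤ ℤ.+ c) ℤ.* c)
  expand = solve 1 (λ c → (con 1ℤ :- con (+ 2) :* (con 1ℤ :+ c)) :* (con 1ℤ :- con (+ 2) :* (con 1ℤ :+ c)) :=
    con 1ℤ :+ con (+ 4) :* ((con 1ℤ :+ c) :* c)) ≡.refl

squareSum : ∀ n → (Fin n → Fin n → ℕ) → ℕ
squareSum n c = offDiagonalSum n λ i j → weight (c i j)

-- The recursion of `offDiagonalSum` with all weights 1: the first row and column contribute n each.
pronic-suc : ∀ n → suc n ℕ.* n ≡ n ℕ.+ n ℕ.+ n ℕ.* (n ∸ 1)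
pronic-suc zero    = ≡.refl
pronic-suc (suc m) = solve 1 (λ m → (con 2 :+ m) :* (con 1 :+ m) := (con 1 :+ m) :+ (con 1 :+ m) :+ (con 1 :+ m) :* m) ≡.refl m
  where open +-*-Solver

pronic≤squareSum : ∀ n c → n ℕ.* (n ∸ 1) ℕ.≤ squareSum n c
pronic≤squareSum zero    c = z≤n
pronic≤squareSum (suc n) c = ℕ.≤-trans (ℕ.≤-reflexive (pronic-suc n))
  (ℕ.+-mono-≤ (ℕ.+-mono-≤ n≤s n≤s) (pronic≤squareSum n λ i j → c (suc i) (suc j)))
  where n≤s = n≤sum (λ j → weight (c zero (suc j))) λ j → 1≤weight (c zero (suc j))

squareSum≡pronic : ∀ n c → (∀ i j → i ≢ j → c i j ℕ.≤ 1) → squareSum n c ≡ n ℕ.* (n ∸ 1)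
squareSum≡pronic zero    c c≤1 = ≡.refl
squareSum≡pronic (suc n) c c≤1 = ≡.trans
  (≡.cong₂ (λ s t → s ℕ.+ s ℕ.+ t)
    (sum≡n (λ j → weight (c zero (suc j))) λ j → c≤1⇒weight≡1 (c≤1 zero (suc j) λ ()))
    (squareSum≡pronic n (λ i j → c (suc i) (suc j)) λ i j i≢j → c≤1 (suc i) (suc j) (i≢j ∘ Fin.suc-injective)))
  (≡.sym (pronic-suc n))

-- Each weight is at least 1, so a total of at most n(n - 1) makes every one of them tight. The sum
-- reads only entries above the diagonal, each counted twice; symmetry carries the bound below it.
squareSum≤pronic⇒≤1 : ∀ n c → (∀ i j → c i j ≡ c j i) → squareSum n c ℕ.≤ n ℕ.* (n ∸ 1) →
  ∀ i j → i ≢ j → c i j ℕ.≤ 1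
squareSum≤pronic⇒≤1 (suc n) c c-sym squareSum≤ = λ
  { zero    zero    0≢0 → contradiction ≡.refl 0≢0
  ; zero    (suc j) _   → row j
  ; (suc i) zero    _   → ≡.subst (ℕ._≤ 1) (c-sym zero (suc i)) (row i)
  ; (suc i) (suc j) i≢j → squareSum≤pronic⇒≤1 n c′ (λ i j → c-sym (suc i) (suc j)) (proj₂ bounds) i j (i≢j ∘ ≡.cong suc)
  }
  where
  c′ = λ i j → c (suc i) (suc j)
  ws = λ j → weight (c zero (suc j))
  1≤ws = λ j → 1≤weight (c zero (suc j))
  n≤s = n≤sum ws 1≤ws
  bounds = +-cancel-bounds (ℕ.+-mono-≤ n≤s n≤s) (pronic≤squareSum n c′)
    (ℕ.≤-trans squareSum≤ (ℕ.≤-reflexive (pronic-suc n)))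
  row : ∀ j → c zero (suc j) ℕ.≤ 1
  row j = weight≤1⇒c≤1 (c zero (suc j)) (sum≤n⇒≤1 ws 1≤ws (proj₁ (+-cancel-bounds n≤s n≤s (proj₁ bounds))) j)

-- Co-degrees

-- Deleting i and then j makes the cardinality drop strictly twice.
two-elements : ∀ {n} {i j : Fin n} {p} → i ≢ j → i ∈ p → j ∈ p → 2 ℕ.≤ ∣ p ∣
two-elements {i = i} {j} {p} i≢j i∈p j∈p = ℕ.≤-<-trans
  (ℕ.≤-<-trans z≤n (Subset.x∈p⇒∣p-x∣<∣p∣ (Subset.x∈p∧x≢y⇒x∈p-y j∈p (i≢j ∘ ≡.sym))))
  (Subset.x∈p⇒∣p-x∣<∣p∣ i∈p)

one-element : ∀ {n} (p : Subset n) → 1 ℕ.≤ ∣ p ∣ → ∃ λ i → i ∈ p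
one-element (inside  ∷ p) _    = zero , here
one-element (outside ∷ p) 1≤∣p∣ = let i , i∈p = one-element p 1≤∣p∣ in suc i , there i∈p

two-elements⁻¹ : ∀ {n} (p : Subset n) → 2 ℕ.≤ ∣ p ∣ → ∃₂ λ i j → i ≢ j × i ∈ p × j ∈ p
two-elements⁻¹ (inside  ∷ p) (s≤s 1≤∣p∣) = let j , j∈p = one-element p 1≤∣p∣ in
  zero , suc j , (λ ()) , here , there j∈p
two-elements⁻¹ (outside ∷ p) 2≤∣p∣ = let i , j , i≢j , i∈p , j∈p = two-elements⁻¹ p 2≤∣p∣ in
  suc i , suc j , i≢j ∘ Fin.suc-injective , there i∈p , there j∈p

two-members : ∀ {A : Set} {x y : A} {xs} → x ≢ y → x ∈ₗ xs → y ∈ₗ xs → 2 ℕ.≤ length xs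
two-members {xs = _ ∷ _ ∷ _} _   _             _             = s≤s (s≤s z≤n)
two-members {xs = _ ∷ []}    x≢y (here ≡.refl) (here ≡.refl) = contradiction ≡.refl x≢y

two-members⁻¹ : ∀ {A : Set} {xs : List A} → Unique xs → 2 ℕ.≤ length xs → ∃₂ λ x y → x ≢ y × x ∈ₗ xs × y ∈ₗ xs
two-members⁻¹ {xs = x ∷ y ∷ _} ((x≢y ∷ _) ∷ _) _ = x , y , x≢y , here ≡.refl , there (here ≡.refl)
two-members⁻¹ {xs = _ ∷ []} _ (s≤s ())

module _ {n} (H : Hypergraph n) where

  both : ∀ i j (e : Subset n) → Dec (i ∈ e × j ∈ e)
  both i j e = (i Subset.∈? e) ×-dec (j Subset.∈? e)

  codegree-sym : ∀ i j → codegree H i j ≡ codegree H j i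
  codegree-sym i j = ≡.cong length (List.filter-≐ (both i j) (both j i) (swap , swap) (edges H))

  -- The edge list has no repetitions, so a co-degree of 2 or more yields two distinct edges, and
  -- these share both i and j.
  linear⇒codegree≤1 : Linear H → ∀ i j → i ≢ j → codegree H i j ℕ.≤ 1
  linear⇒codegree≤1 linear i j i≢j = ℕ.≮⇒≥ λ 2≤c →
    let e , e′ , e≢e′ , e∈ , e′∈ = two-members⁻¹ (Unique.filter⁺ (both i j) (distinct H)) 2≤c
        e∈E , i∈e , j∈e = List.∈-filter⁻ (both i j) e∈
        e′∈E , i∈e′ , j∈e′ = List.∈-filter⁻ (both i j) e′∈
    in ℕ.<⇒≱ (two-elements i≢j (Subset.x∈p∩q⁺ (i∈e , i∈e′)) (Subset.x∈p∩q⁺ (j∈e , j∈e′)))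
         (linear e∈E e′∈E e≢e′)

  codegree≤1⇒linear : (∀ i j → i ≢ j → codegree H i j ℕ.≤ 1) → Linear H
  codegree≤1⇒linear c≤1 {e} {e′} e∈E e′∈E e≢e′ = ℕ.≮⇒≥ λ 2≤∣e∩e′∣ →
    let i , j , i≢j , i∈ , j∈ = two-elements⁻¹ (e ∩ e′) 2≤∣e∩e′∣
        i∈e , i∈e′ = Subset.x∈p∩q⁻ e e′ i∈
        j∈e , j∈e′ = Subset.x∈p∩q⁻ e e′ j∈
    in ℕ.<⇒≱ (two-members e≢e′ (List.∈-filter⁺ (both i j) e∈E (i∈e , j∈e))
                               (List.∈-filter⁺ (both i j) e′∈E (i∈e′ , j∈e′)))
         (c≤1 i j i≢j)

-- Seidel energy

open CharacteristicPolynomial ℝ-rawRing ℝ-isCommutativeRing using (trace²; trace²-hom; sum-squares≈trace²)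

module _ {n} (H : Hypergraph n) where

  seidel-diagonal : ∀ i → seidel H i i ≡ fromℕ 0
  seidel-diagonal i = ≡.cong (λ b → if b then fromℕ 0 else fromℤ (1ℤ ℤ.- + 2 ℤ.* + codegree H i i))
    (dec-true (i Fin.≟ i) ≡.refl)

  seidel-off-diagonal : ∀ i j → i ≢ j → seidel H i j ≡ fromℤ (1ℤ ℤ.- + 2 ℤ.* + codegree H i j)
  seidel-off-diagonal i j i≢j = ≡.cong (λ b → if b then fromℕ 0 else fromℤ (1ℤ ℤ.- + 2 ℤ.* + codegree H i j))
    (dec-false (i Fin.≟ j) i≢j)

  seidel-square : ∀ i j → i ≢ j → seidel H i j * seidel H j i ≃ fromℕ (weight (codegree H i j))
  seidel-square i j i≢j = ≡.subst₂ (λ x y → x * y ≃ fromℕ (weight (codegree H i j)))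
    (≡.sym (seidel-off-diagonal i j i≢j))
    -- Symmetry of the co-degree turns the (j, i) entry into the (i, j) entry, so the product is a
    -- square.
    (≡.sym (≡.trans (seidel-off-diagonal j i (i≢j ∘ ≡.sym)) (≡.cong (λ c → fromℤ (1ℤ ℤ.- + 2 ℤ.* + c)) (codegree-sym H j i))))
    (≡.subst (λ v → fromℤ z * fromℤ z ≃ fromℤ v) (weight-square (codegree H i j))
      (≃-sym (fromℤ (z ℤ.* z)) (fromℤ z * fromℤ z) (fromℤ-* z z)))
    where z = 1ℤ ℤ.- + 2 ℤ.* + codegree H i j

  trace²-seidel : trace² n (seidel H) ≃ fromℕ (squareSum n (codegree H))
  trace²-seidel = trace²-hom fromℕ (≃-refl (fromℕ 0)) (λ a b → fromℤ-+ (+ a) (+ b)) n (seidel H)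
      (λ i j → weight (codegree H i j)) (λ i → pointwise-≃ (seidel H i i) (fromℕ 0) λ k → ≡.cong (λ x → seq x k) (seidel-diagonal i)) seidel-square

  sum-squares-eigenvalues : ∀ ρ → IsSpectrum (seidel H) ρ → (∑ λ i → ρ i * ρ i) ≃ fromℕ (squareSum n (codegree H))
  sum-squares-eigenvalues ρ spectrum =
    ≃-trans (∑ λ i → ρ i * ρ i) (trace² n (seidel H)) (fromℕ (squareSum n (codegree H)))
    (sum-squares≈trace² n (seidel H) ρ spectrum) trace²-seidel

-- With a = n and b = n - 1 this exhibits the Cauchy-Schwarz bound n · n(n - 1) as a square, ready
-- for `square-cancel-≤`.
scaled-root : ∀ a b → fromℕ a * fromℕ (a ℕ.* b) ≃ (fromℕ a * √ b) * (fromℕ a * √ b)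
scaled-root a b = begin
  fromℕ a * fromℕ (a ℕ.* b)          ≈⟨ a*-cong (fromℕ (a ℕ.* b)) (fromℕ a * fromℕ b) (fromℕ-* a b) ⟩
  fromℕ a * (fromℕ a * fromℕ b)      ≈⟨ a*-cong (fromℕ a * (√ b * √ b)) (fromℕ a * fromℕ b)
                                          (a*-cong (√ b * √ b) (fromℕ b) (√-square b)) ⟨
  fromℕ a * (fromℕ a * (√ b * √ b))  ≈⟨ x[xy²]≃[xy]² (fromℕ a) (√ b) ⟩
  (fromℕ a * √ b) * (fromℕ a * √ b)  ∎
  where
  open Relation.Binary.Reasoning.Setoid ≃-setoid
  a*-cong : ∀ x y → x ≃ y → fromℕ a * x ≃ fromℕ a * y
  a*-cong x y = *-cong (fromℕ a) (fromℕ a) x y (≃-refl (fromℕ a))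

module Energy {n} (H : Hypergraph n) (E : ℝ) (ρ : Vector ℝ n)
  (spectrum : IsSpectrum (seidel H) ρ) (E≃Σ∣ρ∣ : E ≃ ∑ λ i → abs (ρ i)) where
  open Relation.Binary.Reasoning.Preorder ≤-preorder

  N : ℕ
  N = n ℕ.* (n ∸ 1)

  Σ∣ρ∣ Σρ² : ℝ
  Σ∣ρ∣ = ∑ λ i → abs (ρ i)
  Σρ² = ∑ λ i → ρ i * ρ i

  Σρ²≃squareSum : Σρ² ≃ fromℕ (squareSum n (codegree H))
  Σρ²≃squareSum = sum-squares-eigenvalues H ρ spectrum

  lower : √ N ≤ E
  lower = begin
    √ N    ≲⟨ square-cancel-≤ (√ N) Σ∣ρ∣ (∑-abs-nonNeg ρ) squares ⟩
    Σ∣ρ∣   ≈⟨ E≃Σ∣ρ∣ ⟨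
    E      ∎
    where
    squares : √ N * √ N ≤ Σ∣ρ∣ * Σ∣ρ∣
    squares = begin
      √ N * √ N                   ≈⟨ √-square N ⟩
      fromℕ N                     ≲⟨ fromℕ-mono-≤ (pronic≤squareSum n (codegree H)) ⟩
      fromℕ (squareSum n (codegree H)) ≈⟨ Σρ²≃squareSum ⟨
      Σρ²                         ≲⟨ ∑²≤[∑∣∣]² ρ ⟩
      Σ∣ρ∣ * Σ∣ρ∣                 ∎

  equality⇒linear : E ≃ √ N → Linear H
  equality⇒linear E≃√N = codegree≤1⇒linear H
    -- The chain of inequalities over the reals ends between two embedded natural numbers, so it can
    -- be pulled back to ℕ, where tightness is read off.
    (squareSum≤pronic⇒≤1 n (codegree H) (codegree-sym H) (fromℕ-cancel-≤ (begin
      fromℕ (squareSum n (codegree H)) ≈⟨ Σρ²≃squareSum ⟨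
      Σρ²                         ≲⟨ ∑²≤[∑∣∣]² ρ ⟩
      Σ∣ρ∣ * Σ∣ρ∣                 ≈⟨ *-cong Σ∣ρ∣ (√ N) Σ∣ρ∣ (√ N) Σ∣ρ∣≃√N Σ∣ρ∣≃√N ⟩
      √ N * √ N                   ≈⟨ √-square N ⟩
      fromℕ N                     ∎)))
    where
    Σ∣ρ∣≃√N : Σ∣ρ∣ ≃ √ N
    Σ∣ρ∣≃√N = ≃-trans Σ∣ρ∣ E (√ N) (≃-sym E Σ∣ρ∣ E≃Σ∣ρ∣) E≃√N

  upper : Linear H → E ≤ fromℕ n * √ (n ∸ 1)
  upper linear = begin
    E                     ≈⟨ E≃Σ∣ρ∣ ⟩
    Σ∣ρ∣                  ≲⟨ square-cancel-≤ Σ∣ρ∣ (fromℕ n * √ (n ∸ 1))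
                              (*-nonNeg (fromℕ n) (√ (n ∸ 1)) (λ _ → 0≤/ n 0) (√-nonNeg (n ∸ 1))) squares ⟩
    fromℕ n * √ (n ∸ 1)   ∎
    where
    Σρ²≃N : Σρ² ≃ fromℕ N
    Σρ²≃N = ≡.subst (λ t → Σρ² ≃ fromℕ t)
      (squareSum≡pronic n (codegree H) (linear⇒codegree≤1 H linear)) Σρ²≃squareSum
    squares : Σ∣ρ∣ * Σ∣ρ∣ ≤ (fromℕ n * √ (n ∸ 1)) * (fromℕ n * √ (n ∸ 1))
    squares = begin
      Σ∣ρ∣ * Σ∣ρ∣                                     ≲⟨ [∑∣∣]²≤n∑² ρ ⟩
      fromℕ n * Σρ²                                   ≈⟨ *-cong (fromℕ n) (fromℕ n) Σρ² (fromℕ N) (≃-refl (fromℕ n)) Σρ²≃N ⟩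
      fromℕ n * fromℕ N                               ≈⟨ scaled-root n (n ∸ 1) ⟩
      (fromℕ n * √ (n ∸ 1)) * (fromℕ n * √ (n ∸ 1))   ∎

theorem3p10 : (k n : ℕ) → 1 ℕ.≤ k → 1 ℕ.≤ n →
    ((H : Hypergraph n) → Uniform k H → (E : ℝ) → IsSeidelEnergy H E →
    √ (n ℕ.* (n ∸ 1)) ≤ E)
    ×
    ((H : Hypergraph n) → Uniform k H → (E : ℝ) → IsSeidelEnergy H E →
    E ≃ √ (n ℕ.* (n ∸ 1)) → Linear H)
    ×
    ((H : Hypergraph n) → Uniform k H → Linear H → (E : ℝ) → IsSeidelEnergy H E →
    √ (n ℕ.* (n ∸ 1)) ≤ E × E ≤ fromℕ n * √ (n ∸ 1))
theorem3p10 k n _ _ =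
    (λ { H _ E (ρ , spectrum , E≃Σ) → Energy.lower H E ρ spectrum E≃Σ })
  , (λ { H _ E (ρ , spectrum , E≃Σ) → Energy.equality⇒linear H E ρ spectrum E≃Σ })
  , (λ { H _ linear E (ρ , spectrum , E≃Σ) →
      Energy.lower H E ρ spectrum E≃Σ , Energy.upper H E ρ spectrum E≃Σ linear })
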